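{- Let $R$ be a Dedekind domain, let $m$ be a positive integer, and let $I=P_1^{\alpha_1}\cdots P_m^{\alpha_m}J$ be a nonzero ideal with $R/I$ finite, where $P_1,\ldots,P_m$ are distinct prime ideals with $|R/P_i|=2$, $\alpha_1,\ldots,\alpha_m$ are positive integers, and $J$ is an ideal of $R$ not divisible by any prime ideal of index $2$. If $J=R$ and $\alpha_i=1$ for all $i$, then every connected component of $G_{R/I}$ has diameter $1$. If $J=R$ and $\alpha_i>1$ for some $i$, then every connected component of $G_{R/I}$ has diameter $2$. If $J\neq R$, then every connected component of $G_{R/I}$ has diameter $3$.
   Context: $G_{R/I}$ is the unitary Cayley graph of $R/I$: vertex set $R/I$, with $a+I$, $b+I$ adjacent iff $a-b+I$ is a unit of $R/I$. -}

module Defs where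

open import Level using (Level; _⊔_) renaming (suc to lsuc)
open import Algebra.Bundles using (CommutativeRing)
open import Data.Nat using (ℕ; zero; suc; _≤_; _<_; _∸_)
open import Data.Fin using (Fin; toℕ) renaming (zero to fzero; suc to fsuc)
open import Data.List using (List; []; _∷_)
open import Data.List.Relation.Unary.All using (All)
open import Data.Product using (Σ; ∃; _×_; _,_; proj₁; proj₂)
open import Data.Sum using (_⊎_)
open import Relation.Nullary using (¬_)
open import Relation.Binary.PropositionalEquality using (_≡_)

module RingDefs {c ℓ : Level} (R : CommutativeRing c ℓ) where
  open CommutativeRing R hiding (zero)

  Pred : Set (lsuc (c ⊔ ℓ))
  Pred = Carrier → Set (c ⊔ ℓ)

  pow : Carrier → ℕ → Carrier
  pow x zero    = 1#
  pow x (suc n) = x * pow x n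

  sumFin : (n : ℕ) → (Fin n → Carrier) → Carrier
  sumFin zero    f = 0#
  sumFin (suc n) f = f fzero + sumFin n (λ i → f (fsuc i))

  record Ideal : Set (lsuc (c ⊔ ℓ)) where
    field
      mem     : Pred
      resp    : ∀ {x y} → x ≈ y → mem x → mem y
      zero-in : mem 0#
      +-closed : ∀ {x y} → mem x → mem y → mem (x + y)
      *-closed : ∀ r {x} → mem x → mem (r * x)
  open Ideal public

  whole : Pred
  whole _ = Lift-top
    where
    open import Data.Unit.Polymorphic using (⊤)
    Lift-top : Set (c ⊔ ℓ)
    Lift-top = ⊤

  _⊆_ : Pred → Pred → Set (c ⊔ ℓ)
  A ⊆ B = ∀ x → A x → B x

  _≐_ : Pred → Pred → Set (c ⊔ ℓ)
  A ≐ B = (A ⊆ B) × (B ⊆ A)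

  sumPairs : List (Carrier × Carrier) → Carrier
  sumPairs []             = 0#
  sumPairs ((a , b) ∷ ps) = a * b + sumPairs ps

  _·_ : Pred → Pred → Pred
  (A · B) x = Σ (List (Carrier × Carrier)) λ ps →
                All (λ p → A (proj₁ p) × B (proj₂ p)) ps × (x ≈ sumPairs ps)

  _^ᴵ_ : Pred → ℕ → Pred
  A ^ᴵ zero  = whole
  A ^ᴵ suc n = A · (A ^ᴵ n)

  prodᴵ : (m : ℕ) → (Fin m → Pred) → Pred
  prodᴵ zero    A = whole
  prodᴵ (suc m) A = A fzero · prodᴵ m (λ i → A (fsuc i))

  generated : List Carrier → Pred
  generated gs x = Σ (List Carrier) λ rs → x ≈ lin rs gs
    where
    lin : List Carrier → List Carrier → Carrier
    lin (r ∷ rs) (g ∷ gs') = r * g + lin rs gs'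
    lin _ _ = 0#

  NonzeroIdeal : Ideal → Set (c ⊔ ℓ)
  NonzeroIdeal I = ∃ λ x → mem I x × ¬ (x ≈ 0#)

  IsPrime : Ideal → Set (c ⊔ ℓ)
  IsPrime P = ¬ mem P 1# × (∀ a b → mem P (a * b) → mem P a ⊎ mem P b)

  IsMaximal : Ideal → Set (lsuc (c ⊔ ℓ))
  IsMaximal P = ¬ mem P 1# × (∀ (K : Ideal) → mem P ⊆ mem K → (mem K ≐ mem P) ⊎ (mem K ≐ whole))

  IsIntegralDomain : Set (c ⊔ ℓ)
  IsIntegralDomain = ¬ (1# ≈ 0#) × (∀ a b → a * b ≈ 0# → (a ≈ 0#) ⊎ (b ≈ 0#))

  IsNoetherian : Set (lsuc (c ⊔ ℓ))
  IsNoetherian = ∀ (I : Ideal) → Σ (List Carrier) λ gs → mem I ≐ generated gs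

  -- x/y (y ≠ 0) integral over R, i.e. (x/y)^n + Σ_{i<n} a_i (x/y)^i = 0,
  -- cleared of denominators: x^n + Σ_{i<n} a_i x^i y^(n-i) = 0; then x/y ∈ R.
  IsIntegrallyClosed : Set (c ⊔ ℓ)
  IsIntegrallyClosed = ∀ (x y : Carrier) → ¬ (y ≈ 0#) → (n : ℕ) → (a : Fin n → Carrier) →
    pow x n + sumFin n (λ i → a i * (pow x (toℕ i) * pow y (n ∸ toℕ i))) ≈ 0# →
    ∃ λ r → x ≈ r * y

  DimAtMostOne : Set (lsuc (c ⊔ ℓ))
  DimAtMostOne = ∀ (P : Ideal) → IsPrime P → NonzeroIdeal P → IsMaximal P

  IsDedekindDomain : Set (lsuc (c ⊔ ℓ))
  IsDedekindDomain = IsIntegralDomain × IsNoetherian × IsIntegrallyClosed × DimAtMostOne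

  _≡[_]_ : Carrier → Ideal → Carrier → Set (c ⊔ ℓ)
  a ≡[ I ] b = mem I (a - b)

  HasIndex : Ideal → ℕ → Set (c ⊔ ℓ)
  HasIndex I n = Σ (Fin n → Carrier) λ r →
    (∀ i j → r i ≡[ I ] r j → i ≡ j) ×
    (∀ x → ∃ λ i → x ≡[ I ] r i)

  FiniteQuotient : Ideal → Set (c ⊔ ℓ)
  FiniteQuotient I = ∃ λ n → HasIndex I n

  IsUnitMod : Ideal → Carrier → Set (c ⊔ ℓ)
  IsUnitMod I a = ∃ λ u → (a * u) ≡[ I ] 1#

  -- unitary Cayley graph G_{R/I}: a + I ~ b + I iff a - b + I is a unit of R/I
  Adj : Ideal → Carrier → Carrier → Set (c ⊔ ℓ)
  Adj I a b = IsUnitMod I (a - b)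

  data Walk (I : Ideal) : Carrier → Carrier → ℕ → Set (c ⊔ ℓ) where
    here : ∀ {a b} → a ≡[ I ] b → Walk I a b zero
    step : ∀ {a b d k} → Adj I a b → Walk I b d k → Walk I a d (suc k)

  Connected : Ideal → Carrier → Carrier → Set (c ⊔ ℓ)
  Connected I a b = ∃ λ k → Walk I a b k

  Dist : Ideal → Carrier → Carrier → ℕ → Set (c ⊔ ℓ)
  Dist I a b d = Walk I a b d × (∀ k → k < d → ¬ Walk I a b k)

  AllComponentsDiameter : Ideal → ℕ → Set (c ⊔ ℓ)
  AllComponentsDiameter I D = ∀ a →
    (∀ b e → Connected I a b → Connected I a e → ∃ λ k → k ≤ D × Walk I b e k) ×
    (∃ λ b → ∃ λ e → Connected I a b × Connected I a e × Dist I b e D)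

{-# OPTIONS --safe #-}
-- Maximality of an index-2 prime, stated for every ideal above it, yields excluded middle, so the
-- argument can be classical.
--
-- If a prime Q of index 2 contained J, then it would divide J: a maximal annihilator modulo an
-- element a ∈ Q provides a fraction b / a that multiplies Q into R but, R being integrally closed,
-- not into Q. So J lies in no such prime, and every element of the finite ring R / J is a sum of
-- two units, as one sees modulo an ideal over J that is maximal without this property. Let N be the
-- intersection of the P i. A unit of R / I is the same as an element that is 1 modulo N and a unit
-- modulo J, and J is comaximal to N. Hence adjacent vertices differ by 1 modulo N, the vertices of
-- a component differ by 0 (even) or 1 (odd) modulo N, and by the Chinese remainder theorem an even
-- difference is a sum of two units and an odd one a sum of three. An element that is 1 modulo N
-- and 0 modulo J ≠ R is at distance 3 from 0; if J = R, odd differences are units, and distance 2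
-- occurs iff N ≠ I.
module Submission where

open import Defs
open import Level using (Level; _⊔_; Lift; lift)
open import Algebra.Bundles using (CommutativeRing)
open import Algebra.Solver.Ring.AlmostCommutativeRing using (fromCommutativeRing; _-Raw-AlmostCommutative⟶_)
open import Data.Nat as ℕ using (ℕ; zero; suc; _≤_; _<_; _∸_; z≤n; s≤s)
open import Data.Integer as ℤ using (ℤ; +_; -[1+_])
open import Data.Fin using (Fin; toℕ; punchIn; punchOut) renaming (zero to fzero; suc to fsuc)
open import Data.Fin.Properties using (suc-injective; pigeonhole; toℕ<n; _≟_; punchInᵢ≢i; punchIn-punchOut)
open import Data.List using (List; []; _∷_)
open import Data.List.Relation.Unary.All as All using (All; []; _∷_)
open import Data.Maybe using (just; nothing)
open import Data.Product using (∃; _×_; _,_; proj₁; proj₂)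
open import Data.Sum using (_⊎_; inj₁; inj₂)
open import Data.Empty using (⊥; ⊥-elim)
open import Relation.Nullary using (¬_; Dec; yes; no)
open import Relation.Nullary.Decidable using (decidable-stable)
open import Relation.Binary.PropositionalEquality as ≡ using (_≡_; _≢_)
open import Relation.Binary.Definitions using (WeaklyDecidable)
import Data.Nat.Properties as ℕₚ
import Data.Integer.Properties as ℤₚ
import Data.Sign as Sign
import Algebra.Solver.Ring
import Algebra.Properties.Ring
import Algebra.Properties.Semiring.Mult.TCOptimised
import Relation.Binary.Reasoning.Setoid

-- Ring identities solved with integer coefficients.

module IntegerSolver {c ℓ : Level} (R : CommutativeRing c ℓ) where
  open CommutativeRing R hiding (zero)
  open Algebra.Properties.Ring ring
  open Algebra.Properties.Semiring.Mult.TCOptimised semiring renaming (_×_ to infixl 8 _×′_)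
  open Relation.Binary.Reasoning.Setoid setoid

  -- Equality in `R` need not be decidable, so the solver's coefficients are integers. The multiples
  -- are the ones for which `⟦ + 1 ⟧` reduces to `1#`.
  ⟦_⟧ : ℤ → Carrier
  ⟦ + n ⟧      = n ×′ 1#
  ⟦ -[1+ n ] ⟧ = - (suc n ×′ 1#)

  neg-homo : ∀ i → ⟦ ℤ.- i ⟧ ≈ - ⟦ i ⟧
  neg-homo (+ zero)  = sym -0#≈0#
  neg-homo (+ suc n) = refl
  neg-homo -[1+ n ]  = sym (-‿involutive _)

  ⊖-homo : ∀ m n → ⟦ m ℤ.⊖ n ⟧ ≈ m ×′ 1# - n ×′ 1#
  ⊖-homo m       zero    = sym (trans (+-congˡ -0#≈0#) (+-identityʳ _))
  ⊖-homo zero    (suc n) = sym (+-identityˡ _)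
  ⊖-homo (suc m) (suc n) = begin
    ⟦ suc m ℤ.⊖ suc n ⟧                     ≡⟨ ≡.cong ⟦_⟧ (ℤₚ.[1+m]⊖[1+n]≡m⊖n m n) ⟩
    ⟦ m ℤ.⊖ n ⟧                             ≈⟨ ⊖-homo m n ⟩
    m ×′ 1# - n ×′ 1#                         ≈⟨ +-congˡ (+-identityˡ _) ⟨
    m ×′ 1# + (0# - n ×′ 1#)                  ≈⟨ +-congˡ (+-congʳ (-‿inverseʳ _)) ⟨
    m ×′ 1# + ((1# - 1#) - n ×′ 1#)           ≈⟨ +-congˡ (+-assoc _ _ _) ⟩
    m ×′ 1# + (1# + (- 1# - n ×′ 1#))         ≈⟨ +-assoc _ _ _ ⟨
    (m ×′ 1# + 1#) + (- 1# - n ×′ 1#)         ≈⟨ +-cong (+-comm _ _) (-‿+-comm _ _) ⟩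
    (1# + m ×′ 1#) - (1# + n ×′ 1#)           ≈⟨ +-cong (sym (1+× m 1#)) (-‿cong (sym (1+× n 1#))) ⟩
    suc m ×′ 1# - suc n ×′ 1#                 ∎

  +-homo : ∀ i j → ⟦ i ℤ.+ j ⟧ ≈ ⟦ i ⟧ + ⟦ j ⟧
  +-homo (+ m)    (+ n)    = ×-homo-+ 1# m n
  +-homo (+ m)    -[1+ n ] = ⊖-homo m (suc n)
  +-homo -[1+ m ] (+ n)    = trans (⊖-homo n (suc m)) (+-comm _ _)
  +-homo -[1+ m ] -[1+ n ] = begin
    - (suc (suc (m ℕ.+ n)) ×′ 1#)            ≡⟨ ≡.cong (λ k → - (suc k ×′ 1#)) (≡.sym (ℕₚ.+-suc m n)) ⟩
    - ((suc m ℕ.+ suc n) ×′ 1#)              ≈⟨ -‿cong (×-homo-+ 1# (suc m) (suc n)) ⟩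
    - (suc m ×′ 1# + suc n ×′ 1#)             ≈⟨ -‿+-comm _ _ ⟨
    - (suc m ×′ 1#) - suc n ×′ 1#             ∎

  pos-homo : ∀ n → ⟦ Sign.+ ℤ.◃ n ⟧ ≈ n ×′ 1#
  pos-homo n = reflexive (≡.cong ⟦_⟧ (ℤₚ.+◃n≡+n n))

  minus-homo : ∀ n → ⟦ Sign.- ℤ.◃ n ⟧ ≈ - (n ×′ 1#)
  minus-homo n = trans (reflexive (≡.cong ⟦_⟧ (ℤₚ.-◃n≡-n n))) (neg-homo (+ n))

  *-homo : ∀ i j → ⟦ i ℤ.* j ⟧ ≈ ⟦ i ⟧ * ⟦ j ⟧
  *-homo (+ m)    (+ n)    = trans (pos-homo (m ℕ.* n)) (×1-homo-* m n)
  *-homo (+ m)    -[1+ n ] = begin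
    ⟦ Sign.- ℤ.◃ (m ℕ.* suc n) ⟧            ≈⟨ minus-homo (m ℕ.* suc n) ⟩
    - ((m ℕ.* suc n) ×′ 1#)                  ≈⟨ -‿cong (×1-homo-* m (suc n)) ⟩
    - ((m ×′ 1#) * (suc n ×′ 1#))             ≈⟨ -‿distribʳ-* _ _ ⟩
    (m ×′ 1#) * - (suc n ×′ 1#)               ∎
  *-homo -[1+ m ] (+ n)    = begin
    ⟦ Sign.- ℤ.◃ (suc m ℕ.* n) ⟧            ≈⟨ minus-homo (suc m ℕ.* n) ⟩
    - ((suc m ℕ.* n) ×′ 1#)                  ≈⟨ -‿cong (×1-homo-* (suc m) n) ⟩
    - ((suc m ×′ 1#) * (n ×′ 1#))             ≈⟨ -‿distribˡ-* _ _ ⟩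
    - (suc m ×′ 1#) * (n ×′ 1#)               ∎
  *-homo -[1+ m ] -[1+ n ] = begin
    ⟦ Sign.+ ℤ.◃ (suc m ℕ.* suc n) ⟧        ≈⟨ pos-homo (suc m ℕ.* suc n) ⟩
    (suc m ℕ.* suc n) ×′ 1#                  ≈⟨ ×1-homo-* (suc m) (suc n) ⟩
    (suc m ×′ 1#) * (suc n ×′ 1#)             ≈⟨ -‿involutive _ ⟨
    - - ((suc m ×′ 1#) * (suc n ×′ 1#))       ≈⟨ -‿cong (-‿distribˡ-* _ _) ⟩
    - (- (suc m ×′ 1#) * (suc n ×′ 1#))       ≈⟨ -‿distribʳ-* _ _ ⟩
    - (suc m ×′ 1#) * - (suc n ×′ 1#)         ∎

  morphism : ℤ.+-*-rawRing -Raw-AlmostCommutative⟶ fromCommutativeRing R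
  morphism = record
    { ⟦_⟧    = ⟦_⟧
    ; +-homo = +-homo
    ; *-homo = *-homo
    ; -‿homo = neg-homo
    ; 0-homo = refl
    ; 1-homo = refl
    }

  _≟⟦⟧_ : WeaklyDecidable (λ i j → ⟦ i ⟧ ≈ ⟦ j ⟧)
  i ≟⟦⟧ j with i ℤ.≟ j
  ... | yes e = just (reflexive (≡.cong ⟦_⟧ e))
  ... | no  _ = nothing

  open Algebra.Solver.Ring ℤ.+-*-rawRing (fromCommutativeRing R) morphism _≟⟦⟧_ public
    using (Polynomial; solve; _:=_; _:+_; _:*_; _:-_; :-_; con)

-- Ideals, units modulo an ideal, comaximality.

module Ideals {c ℓ : Level} (R : CommutativeRing c ℓ) where
  open CommutativeRing R hiding (zero)
  open RingDefs R
  open IntegerSolver R using (Polynomial; solve; _:=_; _:+_; _:*_; _:-_; :-_; con)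

  :1 : ∀ {n} → Polynomial n
  :1 = con (+ 1)

  neg-closed : (I : Ideal) → ∀ {x} → mem I x → mem I (- x)
  neg-closed I {x} x∈I =
    resp I (solve 1 (λ x → (:- :1) :* x := :- x) refl x) (*-closed I (- 1#) x∈I)

  sub-closed : (I : Ideal) → ∀ {x y} → mem I x → mem I y → mem I (x - y)
  sub-closed I x∈I y∈I = +-closed I x∈I (neg-closed I y∈I)

  *-closedʳ : (I : Ideal) → ∀ {x} → mem I x → ∀ r → mem I (x * r)
  *-closedʳ I x∈I r = resp I (*-comm _ _) (*-closed I r x∈I)

  1∈⇒whole : (I : Ideal) → mem I 1# → ∀ x → mem I x
  1∈⇒whole I 1∈I x = resp I (*-identityʳ x) (*-closed I x 1∈I)

  pow-+ : ∀ x m n → pow x (m ℕ.+ n) ≈ pow x m * pow x n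
  pow-+ x zero    n = sym (*-identityˡ _)
  pow-+ x (suc m) n = trans (*-congˡ (pow-+ x m n)) (sym (*-assoc _ _ _))

  _+⟨_⟩ : Ideal → Carrier → Ideal
  K +⟨ x ⟩ = record
    { mem      = λ y → ∃ λ k → ∃ λ r → mem K k × (y ≈ k + r * x)
    ; resp     = λ { y≈z (k , r , k∈K , e) → k , r , k∈K , trans (sym y≈z) e }
    ; zero-in  = 0# , 0# , zero-in K , sym (trans (+-identityˡ _) (zeroˡ x))
    ; +-closed = λ { (k , r , k∈K , e) (k′ , r′ , k′∈K , e′) →
        k + k′ , r + r′ , +-closed K k∈K k′∈K ,
        trans (+-cong e e′)
          (solve 5 (λ k r k′ r′ x → (k :+ r :* x) :+ (k′ :+ r′ :* x) := (k :+ k′) :+ (r :+ r′) :* x)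
            refl k r k′ r′ x) }
    ; *-closed = λ { s (k , r , k∈K , e) →
        s * k , s * r , *-closed K s k∈K ,
        trans (*-congˡ e)
          (solve 4 (λ s k r x → s :* (k :+ r :* x) := s :* k :+ (s :* r) :* x) refl s k r x) }
    }

  +⟨⟩-left : ∀ K x → mem K ⊆ mem (K +⟨ x ⟩)
  +⟨⟩-left K x k k∈K = k , 0# , k∈K , sym (trans (+-congˡ (zeroˡ x)) (+-identityʳ k))

  +⟨⟩-right : ∀ K x → mem (K +⟨ x ⟩) x
  +⟨⟩-right K x = 0# , 1# , zero-in K , sym (trans (+-identityˡ _) (*-identityˡ x))

  +⟨⟩-least : ∀ K L x → mem K ⊆ mem L → mem L x → mem (K +⟨ x ⟩) ⊆ mem L
  +⟨⟩-least K L x K⊆L x∈L y (k , r , k∈K , e) =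
    resp L (sym e) (+-closed L (K⊆L k k∈K) (*-closed L r x∈L))

  +⟨⟩-product : ∀ K {x y} → ∀ {a b} → mem (K +⟨ x ⟩) a → mem (K +⟨ y ⟩) b → mem (K +⟨ x * y ⟩) (a * b)
  +⟨⟩-product K {x} {y} (k , r , k∈K , e) (k′ , r′ , k′∈K , e′) =
    k * (k′ + r′ * y) + (r * x) * k′ , r * r′ ,
    +-closed K (*-closedʳ K k∈K _) (*-closed K _ k′∈K) ,
    trans (*-cong e e′)
      (solve 6 (λ k r x k′ r′ y → (k :+ r :* x) :* (k′ :+ r′ :* y)
                 := (k :* (k′ :+ r′ :* y) :+ (r :* x) :* k′) :+ (r :* r′) :* (x :* y))
        refl k r x k′ r′ y)

  -- The colon ideal, the candidate for the cofactor of `Q` in `J`.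
  _∶_ : Ideal → Ideal → Ideal
  J ∶ Q = record
    { mem      = λ x → ∀ y → mem Q y → mem J (y * x)
    ; resp     = λ x≈z h y y∈Q → resp J (*-congˡ x≈z) (h y y∈Q)
    ; zero-in  = λ y _ → resp J (sym (zeroʳ y)) (zero-in J)
    ; +-closed = λ h h′ y y∈Q → resp J (sym (distribˡ _ _ _)) (+-closed J (h y y∈Q) (h′ y y∈Q))
    ; *-closed = λ r {x} h y y∈Q →
        resp J (solve 3 (λ r y x → r :* (y :* x) := y :* (r :* x)) refl r y x) (*-closed J r (h y y∈Q))
    }

  -- For nonzero `a` in a domain: the y with (b / a) y in `Q`, written without denominators. With
  -- the whole ring as `Q` it is the annihilator of `b` modulo `a`.
  multiplesWith : Carrier → Carrier → Ideal → Ideal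
  multiplesWith a b Q = record
    { mem      = λ y → ∃ λ z → mem Q z × (b * y ≈ a * z)
    ; resp     = λ { x≈y (z , z∈Q , e) → z , z∈Q , trans (*-congˡ (sym x≈y)) e }
    ; zero-in  = 0# , zero-in Q , trans (zeroʳ b) (sym (zeroʳ a))
    ; +-closed = λ { (z , z∈Q , e) (z′ , z′∈Q , e′) → z + z′ , +-closed Q z∈Q z′∈Q ,
        trans (distribˡ _ _ _) (trans (+-cong e e′) (sym (distribˡ _ _ _))) }
    ; *-closed = λ { r {x} (z , z∈Q , e) → r * z , *-closed Q r z∈Q ,
        trans (solve 3 (λ b r x → b :* (r :* x) := r :* (b :* x)) refl b r x)
          (trans (*-congˡ e) (solve 3 (λ a r z → r :* (a :* z) := a :* (r :* z)) refl a r z)) }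
    }

  wholeIdeal : Ideal
  wholeIdeal = record
    { mem = whole ; resp = λ _ _ → _ ; zero-in = _ ; +-closed = λ _ _ → _ ; *-closed = λ _ _ → _ }

  ⋂ : ∀ {m} → (Fin m → Ideal) → Ideal
  ⋂ P = record
    { mem      = λ x → ∀ i → mem (P i) x
    ; resp     = λ e h i → resp (P i) e (h i)
    ; zero-in  = λ i → zero-in (P i)
    ; +-closed = λ h h′ i → +-closed (P i) (h i) (h′ i)
    ; *-closed = λ r h i → *-closed (P i) r (h i)
    }

  ·-least : {A B : Pred} (K : Ideal) → (∀ {a b} → A a → B b → mem K (a * b)) → (A · B) ⊆ mem K
  ·-least {A} {B} K f x (ps , all , e) = resp K (sym e) (go ps all)
    where
    go : ∀ ps → All (λ p → A (proj₁ p) × B (proj₂ p)) ps → mem K (sumPairs ps)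
    go []       []               = zero-in K
    go (_ ∷ ps) ((a , b) ∷ all) = +-closed K (f a b) (go ps all)

  ·-single : ∀ {A B : Pred} {a b x} → A a → B b → x ≈ a * b → (A · B) x
  ·-single a∈A b∈B e = _ ∷ [] , (a∈A , b∈B) ∷ [] , trans e (sym (+-identityʳ _))

  ·-pair : ∀ {A B : Pred} {a b a′ b′ x} → A a → B b → A a′ → B b′ → x ≈ a * b + a′ * b′ → (A · B) x
  ·-pair a b a′ b′ e = _ ∷ _ ∷ [] , (a , b) ∷ (a′ , b′) ∷ [] , trans e (+-congˡ (sym (+-identityʳ _)))

  ^ᴵ-⊆ : (A : Ideal) → ∀ n → 1 ≤ n → (mem A ^ᴵ n) ⊆ mem A
  ^ᴵ-⊆ A (suc n) _ = ·-least A (λ a∈A _ → *-closedʳ A a∈A _)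

  ^ᴵ-⊆-square : (A K : Ideal) → (∀ {a b} → mem A a → mem A b → mem K (a * b)) →
                ∀ n → 1 < n → (mem A ^ᴵ n) ⊆ mem K
  ^ᴵ-⊆-square A K f (suc n) (s≤s 1≤n) = ·-least K (λ a∈A b∈Aⁿ → f a∈A (^ᴵ-⊆ A n 1≤n _ b∈Aⁿ))

  prodᴵ-⊆ : ∀ m (A : Fin m → Pred) i (K : Ideal) → A i ⊆ mem K → prodᴵ m A ⊆ mem K
  prodᴵ-⊆ (suc m) A fzero    K A⊆K = ·-least K (λ a _ → *-closedʳ K (A⊆K _ a) _)
  prodᴵ-⊆ (suc m) A (fsuc i) K A⊆K = ·-least K (λ _ b → *-closed K _ (prodᴵ-⊆ m (λ j → A (fsuc j)) i K A⊆K _ b))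

  prodᴵ-·-⊆ : ∀ m (A : Fin m → Pred) B i (K : Ideal) → A i ⊆ mem K → (prodᴵ m A · B) ⊆ mem K
  prodᴵ-·-⊆ m A B i K A⊆K = ·-least K (λ a _ → *-closedʳ K (prodᴵ-⊆ m A i K A⊆K _ a) _)

  prodᴵ-mono : ∀ m {A B : Fin m → Pred} → (∀ i → A i ⊆ B i) → prodᴵ m A ⊆ prodᴵ m B
  prodᴵ-mono zero    f x _ = _
  prodᴵ-mono (suc m) f x (ps , all , e) =
    ps , All.map (λ { (a , b) → f fzero _ a , prodᴵ-mono m (λ i → f (fsuc i)) _ b }) all , e

  -- Products of ideals are only predicates here, so units modulo them need this variant of
  -- `IsUnitMod`. The form 1 - x u makes the expressions multiply well.
  Invertible : Pred → Carrier → Set (c ⊔ ℓ)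
  Invertible A x = ∃ λ u → A (1# - x * u)

  -- The witness w solves 1 - x w = (1 - x u) (1 - x v), whose right side lies in the product.
  invertible-· : ∀ {A B : Pred} {x} → Invertible A x → Invertible B x → Invertible (A · B) x
  invertible-· {x = x} (u , a) (v , b) = (u + v) - x * (u * v) , ·-single a b
    (solve 3 (λ x u v → :1 :- x :* ((u :+ v) :- x :* (u :* v)) := (:1 :- x :* u) :* (:1 :- x :* v)) refl x u v)

  invertible-^ᴵ : ∀ {A : Pred} {x} → Invertible A x → ∀ n → Invertible (A ^ᴵ n) x
  invertible-^ᴵ h zero    = 0# , _
  invertible-^ᴵ h (suc n) = invertible-· h (invertible-^ᴵ h n)

  invertible-prodᴵ : ∀ m {A : Fin m → Pred} {x} → (∀ i → Invertible (A i) x) → Invertible (prodᴵ m A) x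
  invertible-prodᴵ zero    h = 0# , _
  invertible-prodᴵ (suc m) h = invertible-· (h fzero) (invertible-prodᴵ m (λ i → h (fsuc i)))

  unit⇒invertible : (I : Ideal) → ∀ {x} → IsUnitMod I x → Invertible (mem I) x
  unit⇒invertible I {x} (u , h) =
    u , resp I (solve 2 (λ x u → :- (x :* u :- :1) := :1 :- x :* u) refl x u) (neg-closed I h)

  invertible⇒unit : (I : Ideal) → ∀ {x} → Invertible (mem I) x → IsUnitMod I x
  invertible⇒unit I {x} (u , h) =
    u , resp I (solve 2 (λ x u → :- (:1 :- x :* u) := x :* u :- :1) refl x u) (neg-closed I h)

  unit-mono : (A B : Ideal) → mem A ⊆ mem B → ∀ {x} → IsUnitMod A x → IsUnitMod B x
  unit-mono A B A⊆B (u , h) = u , A⊆B _ h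

  unit-cong : (I : Ideal) → ∀ {x y} → mem I (x - y) → IsUnitMod I x → IsUnitMod I y
  unit-cong I {x} {y} x≡y (u , h) = u ,
    resp I (solve 3 (λ x y u → (x :* u :- :1) :- (x :- y) :* u := y :* u :- :1) refl x y u)
      (sub-closed I h (*-closedʳ I x≡y u))

  unit-≈ : (I : Ideal) → ∀ {x y} → x ≈ y → IsUnitMod I x → IsUnitMod I y
  unit-≈ I x≈y (u , h) = u , resp I (+-congʳ (*-congʳ x≈y)) h

  unit-product : (A B K : Ideal) → (∀ {a b} → mem A a → mem B b → mem K (a * b)) →
                 ∀ {x} → IsUnitMod A x → IsUnitMod B x → IsUnitMod K x
  unit-product A B K f x∈A x∈B
    with w , h ← invertible-· (unit⇒invertible A x∈A) (unit⇒invertible B x∈B)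
    = invertible⇒unit K (w , ·-least K f _ h)

  unit-factorˡ : (I : Ideal) → ∀ {x y} → IsUnitMod I (x * y) → IsUnitMod I x
  unit-factorˡ I {x} {y} (u , h) = y * u , resp I (+-congʳ (*-assoc x y u)) h

  unit-* : (I : Ideal) → ∀ {x y} → IsUnitMod I x → IsUnitMod I y → IsUnitMod I (x * y)
  unit-* I {x} {y} (u , h) (v , k) = u * v ,
    resp I (solve 4 (λ x y u v → (x :* u :- :1) :* (y :* v) :+ (y :* v :- :1) := (x :* y) :* (u :* v) :- :1)
             refl x y u v)
      (+-closed I (*-closedʳ I h _) k)

  unit-1 : (I : Ideal) → IsUnitMod I 1#
  unit-1 I = 1# , resp I (solve 0 (con (+ 0) := :1 :* :1 :- :1) refl) (zero-in I)

  unit-pow : (I : Ideal) → ∀ {x} → IsUnitMod I x → ∀ n → IsUnitMod I (pow x n)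
  unit-pow I h zero    = unit-1 I
  unit-pow I h (suc n) = unit-* I h (unit-pow I h n)

  unit-cancel : (I : Ideal) → ∀ {x y} → IsUnitMod I x → mem I (x * y) → mem I y
  unit-cancel I {x} {y} (u , h) xy∈I =
    resp I (solve 3 (λ x y u → (x :* y) :* u :- (x :* u :- :1) :* y := y) refl x y u)
      (sub-closed I (*-closedʳ I xy∈I u) (*-closedʳ I h y))

  -- The sum of `B` and `A` is the whole ring, given through the element, 0 modulo `B` and 1 modulo
  -- `A`, that Chinese remainder arguments use.
  Comaximal : Ideal → Ideal → Set (c ⊔ ℓ)
  Comaximal B A = ∃ λ s → mem B s × mem A (1# - s)

  -- (1 - d) (1 - s) lies in the first ideal by its second factor and in the others by its first,
  -- and it differs from 1 by an element of `B`.
  comaximal-⋂ : (B : Ideal) → ∀ {m} (P : Fin m → Ideal) → (∀ i → Comaximal B (P i)) → Comaximal B (⋂ P)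
  comaximal-⋂ B {zero}  P h = 0# , zero-in B , λ ()
  comaximal-⋂ B {suc m} P h with h fzero | comaximal-⋂ B (λ i → P (fsuc i)) (λ i → h (fsuc i))
  ... | s , s∈B , s≡1 | d , d∈B , d≡1 =
    s + d * (1# - s) , +-closed B s∈B (*-closedʳ B d∈B _) , λ where
      fzero    → resp (P fzero) (eq s d) (*-closed (P fzero) (1# - d) s≡1)
      (fsuc i) → resp (P (fsuc i)) (eq s d) (*-closedʳ (P (fsuc i)) (d≡1 i) (1# - s))
    where
    eq : ∀ s d → (1# - d) * (1# - s) ≈ 1# - (s + d * (1# - s))
    eq = solve 2 (λ s d → (:1 :- d) :* (:1 :- s) := :1 :- (s :+ d :* (:1 :- s))) refl

  -- With `d` in the first ideal and 1 - d in all others, both terms of x = d x + x (1 - d) lie in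
  -- the first ideal times the product of the rest.
  ⋂⊆prodᴵ : ∀ m (P : Fin m → Ideal) → (∀ i j → i ≢ j → Comaximal (P i) (P j)) →
            mem (⋂ P) ⊆ prodᴵ m (λ i → mem (P i))
  ⋂⊆prodᴵ zero    P h x x∈P = _
  ⋂⊆prodᴵ (suc m) P h x x∈P with comaximal-⋂ (P fzero) (λ i → P (fsuc i)) (λ i → h fzero (fsuc i) λ ())
  ... | d , d∈P₀ , d≡1 =
    ·-pair d∈P₀ (rest x (λ i → x∈P (fsuc i))) (x∈P fzero) (rest (1# - d) d≡1)
      (solve 2 (λ d x → x := d :* x :+ x :* (:1 :- d)) refl d x)
    where
    rest = ⋂⊆prodᴵ m (λ i → P (fsuc i)) (λ i j i≢j → h (fsuc i) (fsuc j) (λ e → i≢j (suc-injective e)))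

-- Ascending chains, and powers in a finite quotient.

module Chains {c ℓ : Level} (R : CommutativeRing c ℓ)
  (noetherian : RingDefs.IsNoetherian R) (lem : (A : Set (c ⊔ ℓ)) → Dec A) where
  open CommutativeRing R hiding (zero)
  open RingDefs R
  open Ideals R
  open IntegerSolver R using (solve; _:=_; _:+_; _:*_; _:-_; :-_; con)

  stable : {A : Set (c ⊔ ℓ)} → ¬ ¬ A → A
  stable {A} = decidable-stable (lem A)

  generated-least : (K : Ideal) → ∀ gs x → All (mem K) gs → generated gs x → mem K x
  generated-least K []       x _        ([] , e)     = resp K (sym e) (zero-in K)
  generated-least K []       x _        (r ∷ rs , e) = resp K (sym e) (zero-in K)
  generated-least K (g ∷ gs) x _        ([] , e)     = resp K (sym e) (zero-in K)
  generated-least K (g ∷ gs) x (p ∷ ps) (r ∷ rs , e) =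
    resp K (sym e) (+-closed K (*-closed K r p) (generated-least K gs _ ps (rs , refl)))

  generated-∷ : ∀ g gs {x} → generated gs x → generated (g ∷ gs) x
  generated-∷ g gs (rs , e) = 0# ∷ rs , trans e (sym (trans (+-congʳ (zeroˡ g)) (+-identityˡ _)))

  generators∈generated : ∀ gs → All (generated gs) gs
  generators∈generated []       = []
  generators∈generated (g ∷ gs) =
    (1# ∷ [] , sym (trans (+-identityʳ _) (*-identityˡ g))) ∷
    All.map (generated-∷ g gs) (generators∈generated gs)

  chain-mono : (F : ℕ → Ideal) → (∀ n → mem (F n) ⊆ mem (F (suc n))) →
               ∀ {m n} → m ≤ n → mem (F m) ⊆ mem (F n)
  chain-mono F F⊆ m≤n = go (ℕₚ.≤⇒≤′ m≤n)
    where
    go : ∀ {m n} → m ℕ.≤′ n → mem (F m) ⊆ mem (F n)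
    go ℕ.≤′-refl       x x∈ = x∈
    go (ℕ.≤′-step m≤n) x x∈ = F⊆ _ x (go m≤n x x∈)

  -- The union of the chain is finitely generated, and its generators all occur by some stage.
  chain-stabilises : (F : ℕ → Ideal) → (∀ n → mem (F n) ⊆ mem (F (suc n))) →
                     ∃ λ N → ∀ n → mem (F n) ⊆ mem (F N)
  chain-stabilises F F⊆ = N , λ n x x∈ →
    generated-least (F N) gs x gs∈F (proj₁ union≐ x (n , x∈))
    where
    mono = chain-mono F F⊆
    union : Ideal
    union = record
      { mem      = λ x → ∃ λ n → mem (F n) x
      ; resp     = λ { e (n , h) → n , resp (F n) e h }
      ; zero-in  = 0 , zero-in (F 0)
      ; +-closed = λ { (m , h) (n , k) → m ℕ.+ n ,
          +-closed (F (m ℕ.+ n)) (mono (ℕₚ.m≤m+n m n) _ h) (mono (ℕₚ.m≤n+m n m) _ k) }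
      ; *-closed = λ { r (n , h) → n , *-closed (F n) r h }
      }
    gs = proj₁ (noetherian union)
    union≐ = proj₂ (noetherian union)
    bound : ∀ {xs} → All (mem union) xs → ∃ λ N → All (mem (F N)) xs
    bound []            = 0 , []
    bound ((n , h) ∷ hs) with bound hs
    ... | N , ks = n ℕ.+ N , mono (ℕₚ.m≤m+n n N) _ h ∷ All.map (mono (ℕₚ.m≤n+m N n) _) ks
    bounded = bound (All.map (λ {x} → proj₂ union≐ x) (generators∈generated gs))
    N = proj₁ bounded
    gs∈F = proj₂ bounded

  -- The ideals are indexed by a small type, since quantifying over `Ideal` would leave the universe
  -- in which `lem` decides.
  Maximal : {X : Set c} → (X → Ideal) → (X → Set (c ⊔ ℓ)) → X → Set (c ⊔ ℓ)
  Maximal F P x = P x × (∀ y → P y → mem (F x) ⊆ mem (F y) → mem (F y) ⊆ mem (F x))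

  -- Otherwise every member has a strictly larger one, and iterating this gives a chain that never
  -- stabilises.
  maximal-member : {X : Set c} (F : X → Ideal) (P : X → Set (c ⊔ ℓ)) → ∃ P → ∃ (Maximal F P)
  maximal-member {X} F P start = stable impossible
    where
    Larger : X → Set (c ⊔ ℓ)
    Larger x = ∃ λ y → P y × (mem (F x) ⊆ mem (F y)) × ∃ λ z → mem (F y) z × ¬ mem (F x) z
    module _ (noMax : ¬ ∃ (Maximal F P)) where
      larger : ∀ x → P x → Larger x
      larger x p = stable λ none → noMax (x , p , λ y q x⊆y z z∈y →
        stable λ z∉x → none (y , q , x⊆y , z , z∈y , z∉x))
      sequence : ℕ → ∃ P
      sequence zero    = start
      sequence (suc n) with larger _ (proj₂ (sequence n))
      ... | y , q , _ = y , q
      chain : ℕ → Ideal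
      chain n = F (proj₁ (sequence n))
      chain⊆ : ∀ n → mem (chain n) ⊆ mem (chain (suc n))
      chain⊆ n with larger _ (proj₂ (sequence n))
      ... | _ , _ , x⊆y , _ = x⊆y
      strict : ∀ n → ∃ λ z → mem (chain (suc n)) z × ¬ mem (chain n) z
      strict n with larger _ (proj₂ (sequence n))
      ... | _ , _ , _ , z = z
      impossible : ⊥
      impossible with chain-stabilises chain chain⊆
      ... | N , stops with strict N
      ... | z , z∈ , z∉ = z∉ (stops (suc N) z z∈)

  -- Lists serve as small codes for the ideals above `J`; by `adjoin-generators` they reach all of
  -- them.
  adjoin : Ideal → List Carrier → Ideal
  adjoin J []       = J
  adjoin J (g ∷ gs) = adjoin J gs +⟨ g ⟩

  adjoin-⊇ : ∀ J gs → mem J ⊆ mem (adjoin J gs)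
  adjoin-⊇ J []       x x∈J = x∈J
  adjoin-⊇ J (g ∷ gs) x x∈J = +⟨⟩-left (adjoin J gs) g x (adjoin-⊇ J gs x x∈J)

  generators∈adjoin : ∀ J gs → All (mem (adjoin J gs)) gs
  generators∈adjoin J []       = []
  generators∈adjoin J (g ∷ gs) =
    +⟨⟩-right (adjoin J gs) g ∷
    All.map (λ {x} → +⟨⟩-left (adjoin J gs) g x) (generators∈adjoin J gs)

  adjoin-least : (J L : Ideal) → mem J ⊆ mem L → ∀ gs → All (mem L) gs → mem (adjoin J gs) ⊆ mem L
  adjoin-least J L J⊆L []       []       = J⊆L
  adjoin-least J L J⊆L (g ∷ gs) (p ∷ ps) =
    +⟨⟩-least (adjoin J gs) L g (adjoin-least J L J⊆L gs ps) p

  adjoin-generators : (J L : Ideal) → mem J ⊆ mem L → ∃ λ gs → mem (adjoin J gs) ≐ mem L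
  adjoin-generators J L J⊆L with noetherian L
  ... | gs , L⊆gs , gs⊆L = gs ,
    adjoin-least J L J⊆L gs (All.map (λ {x} → gs⊆L x) (generators∈generated gs)) ,
    λ x x∈L → generated-least (adjoin J gs) gs x (generators∈adjoin J gs) (L⊆gs x x∈L)

  index-2-from-cover : (K : Ideal) → ¬ mem K 1# → (∀ x → mem K x ⊎ mem K (1# - x)) → HasIndex K 2
  index-2-from-cover K 1∉K cover = r , distinct , covers
    where
    r : Fin 2 → Carrier
    r fzero     = 0#
    r (fsuc _)  = 1#
    distinct : ∀ i j → r i ≡[ K ] r j → i ≡ j
    distinct fzero        fzero        _ = ≡.refl
    distinct fzero        (fsuc fzero) h = ⊥-elim (1∉K
      (resp K (solve 0 (:- (con (+ 0) :- :1) := :1) refl) (neg-closed K h)))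
    distinct (fsuc fzero) fzero        h = ⊥-elim (1∉K
      (resp K (solve 0 (:1 :- con (+ 0) := :1) refl) h))
    distinct (fsuc fzero) (fsuc fzero) _ = ≡.refl
    covers : ∀ x → ∃ λ i → x ≡[ K ] r i
    covers x with cover x
    ... | inj₁ x∈K   = fzero , resp K (solve 1 (λ x → x := x :- con (+ 0)) refl x) x∈K
    ... | inj₂ 1-x∈K = fsuc fzero , resp K (solve 1 (λ x → :- (:1 :- x) := x :- :1) refl x) (neg-closed K 1-x∈K)

  -- The product of K + (x) and K + (x^n) lies in K + (x^(n+1)), so units lift by induction.
  unit-modulo-power : (K : Ideal) → ∀ x {z} → IsUnitMod (K +⟨ x ⟩) z → ∀ n → IsUnitMod (K +⟨ pow x n ⟩) z
  unit-modulo-power K x     h zero    = 0# , 1∈⇒whole (K +⟨ 1# ⟩) (+⟨⟩-right K 1#) _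
  unit-modulo-power K x {z} h (suc n) =
    unit-product (K +⟨ x ⟩) (K +⟨ pow x n ⟩) (K +⟨ pow x (suc n) ⟩) (+⟨⟩-product K)
      h (unit-modulo-power K x h n)

  -- Among the powers with exponents 0 to n two share one of the n classes; their difference is x^i
  -- (1 - x^(k+1)) for exponents i and i + k + 1.
  powers-repeat : (J : Ideal) → FiniteQuotient J → ∀ x →
                  ∃ λ i → ∃ λ k → mem J (pow x i * (1# - pow x (suc k)))
  powers-repeat J (n , r , _ , cover) x with pigeonhole (ℕₚ.n<1+n n) (λ i → proj₁ (cover (pow x (toℕ i))))
  ... | i , j , i<j , same = toℕ i , k , resp J factor (resp J cancel
      (sub-closed J (proj₂ (cover p)) (≡.subst (λ l → mem J (q - r l)) (≡.sym same) (proj₂ (cover q)))))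
    where
    p = pow x (toℕ i)
    q = pow x (toℕ j)
    s = r (proj₁ (cover p))
    k = toℕ j ∸ suc (toℕ i)
    j≡ : toℕ j ≡ toℕ i ℕ.+ suc k
    j≡ = ≡.trans (≡.sym (ℕₚ.m+[n∸m]≡n i<j)) (≡.sym (ℕₚ.+-suc (toℕ i) k))
    q≈ : q ≈ p * pow x (suc k)
    q≈ = trans (reflexive (≡.cong (pow x) j≡)) (pow-+ x (toℕ i) (suc k))
    cancel : (p - s) - (q - s) ≈ p - q
    cancel = solve 3 (λ p q s → (p :- s) :- (q :- s) := p :- q) refl p q s
    factor : p - q ≈ p * (1# - pow x (suc k))
    factor = trans (+-congˡ (-‿cong q≈)) (solve 2 (λ p y → p :- p :* y := p :* (:1 :- y)) refl p (pow x (suc k)))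

  -- Modulo `B`, x^k inverts `x`, so p = x^i has an inverse v; then p v lies in `A` and 1 - p v in
  -- `B`.
  powers-comaximal : (A B : Ideal) → ∀ x i k → mem A (pow x i) → mem B (1# - pow x (suc k)) → Comaximal B A
  powers-comaximal A B x i k a b = 1# - p * v , proj₂ inverse , resp A p*v≈ (*-closedʳ A a v)
    where
    p = pow x i
    x-unit : IsUnitMod B x
    x-unit = invertible⇒unit B (pow x k , b)
    inverse : Invertible (mem B) p
    inverse = unit⇒invertible B (unit-pow B x-unit i)
    v = proj₁ inverse
    p*v≈ : p * v ≈ 1# - (1# - p * v)
    p*v≈ = solve 2 (λ p v → p :* v := :1 :- (:1 :- p :* v)) refl p v

  -- Sums of two units modulo an ideal.

  module UnitSums (d : Carrier) where

    -- A product is a unit exactly when both factors are, so `d` is here a sum of two units modulo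
    -- `K`.
    Good : Ideal → Set (c ⊔ ℓ)
    Good K = ∃ λ u → IsUnitMod K (u * (d - u))

    good-mono : (A B : Ideal) → mem A ⊆ mem B → Good A → Good B
    good-mono A B A⊆B (u , h) = u , unit-mono A B A⊆B h

    good-nilpotent : (K : Ideal) → ∀ x n → mem K (pow x n) → Good (K +⟨ x ⟩) → Good K
    good-nilpotent K x n xⁿ∈K (u , h) =
      u , unit-mono (K +⟨ pow x n ⟩) K (+⟨⟩-least K K _ (λ _ k → k) xⁿ∈K) (unit-modulo-power K x h n)

    -- The Chinese remainder element `w` is `u` modulo `A` and `v` modulo `B`. The identity used is
    -- u (d - u) - w (d - w) = (u - w) (d - u - w) with u - w = (1 - s) (u - v), and likewise for
    -- `v`.
    good-comaximal : (A B K : Ideal) → Comaximal B A → (∀ {a b} → mem A a → mem B b → mem K (a * b)) →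
                     Good A → Good B → Good K
    good-comaximal A B K (s , s∈B , 1-s∈A) AB⊆K (u , hu) (v , hv) = w ,
      unit-product A B K AB⊆K
        (unit-cong A (resp A
            (solve 4 (λ d u v s → let w = u :* s :+ v :* (:1 :- s) in
                       (:1 :- s) :* ((u :- v) :* (d :- u :- w)) := u :* (d :- u) :- w :* (d :- w))
              refl d u v s)
            (*-closedʳ A 1-s∈A _)) hu)
        (unit-cong B (resp B
            (solve 4 (λ d u v s → let w = u :* s :+ v :* (:1 :- s) in
                       s :* ((v :- u) :* (d :- v :- w)) := v :* (d :- v) :- w :* (d :- w))
              refl d u v s)
            (*-closedʳ B s∈B _)) hv)
      where w = u * s + v * (1# - s)

    -- An ideal maximal among the bad ones over J is prime: modulo it every element is nilpotent, a
    -- unit, or (some power being a nontrivial idempotent) splits the quotient.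
    good-finite : (I J : Ideal) → FiniteQuotient I → mem I ⊆ mem J →
                  (∀ Q → IsPrime Q → HasIndex Q 2 → ¬ (mem J ⊆ mem Q)) → Good J
    good-finite I J finite I⊆J noIndex2 = stable λ bad →
      no-maximal-bad (maximal-member (adjoin J) (λ gs → ¬ Good (adjoin J gs)) ([] , bad))
      where
      no-maximal-bad : ¬ ∃ (Maximal (adjoin J) (λ gs → ¬ Good (adjoin J gs)))
      no-maximal-bad (gs , bad , max) = noIndex2 K (1∉K , prime) (index-2-from-cover K 1∉K zero-or-one) J⊆K
        where
        K = adjoin J gs
        J⊆K = adjoin-⊇ J gs

        -- K + (x) is coded by some list; were it bad, maximality would put `x` into `K`.
        good-above : ∀ x → ¬ mem K x → Good (K +⟨ x ⟩)
        good-above x x∉K = stable λ bad′ →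
          let hs , hs⊆ , ⊆hs = adjoin-generators J (K +⟨ x ⟩) (λ y y∈J → +⟨⟩-left K x y (J⊆K y y∈J))
          in x∉K (max hs (λ good → bad′ (good-mono (adjoin J hs) (K +⟨ x ⟩) hs⊆ good))
                   (λ y y∈K → ⊆hs y (+⟨⟩-left K x y y∈K)) x (⊆hs x (+⟨⟩-right K x)))

        1∉K : ¬ mem K 1#
        1∉K 1∈K = bad (0# , 0# , 1∈⇒whole K 1∈K _)

        unit-of-relation : ∀ x i k → mem K (pow x i * (1# - pow x (suc k))) → ¬ mem K x → IsUnitMod K x
        unit-of-relation x i k rel x∉K with lem (mem K (pow x i)) | lem (mem K (1# - pow x (suc k)))
        ... | yes xⁱ∈K | _      = ⊥-elim (bad (good-nilpotent K x i xⁱ∈K (good-above x x∉K)))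
        ... | no _     | yes h  = invertible⇒unit K (pow x k , h)
        ... | no xⁱ∉K  | no h∉K = ⊥-elim (bad
          (good-comaximal A B K (powers-comaximal A B x i k (+⟨⟩-right K _) (+⟨⟩-right K _))
            (λ {a} {b} a∈A b∈B → +⟨⟩-least K K _ (λ _ k∈ → k∈) rel (a * b) (+⟨⟩-product K a∈A b∈B))
            (good-above _ xⁱ∉K) (good-above _ h∉K)))
          where
          A = K +⟨ pow x i ⟩
          B = K +⟨ 1# - pow x (suc k) ⟩

        unit : ∀ x → ¬ mem K x → IsUnitMod K x
        unit x with powers-repeat I finite x
        ... | i , k , rel = unit-of-relation x i k (J⊆K _ (I⊆J _ rel))

        prime : ∀ x y → mem K (x * y) → mem K x ⊎ mem K y
        prime x y xy∈K with lem (mem K x)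
        ... | yes x∈K = inj₁ x∈K
        ... | no x∉K  = inj₂ (unit-cancel K (unit x x∉K) xy∈K)

        zero-or-d : ∀ u → mem K u ⊎ mem K (d - u)
        zero-or-d u with lem (mem K u) | lem (mem K (d - u))
        ... | yes h | _     = inj₁ h
        ... | no _  | yes h = inj₂ h
        ... | no h  | no h′ = ⊥-elim (bad (u , unit-* K (unit u h) (unit (d - u) h′)))

        -- Since 1 is not in `K`, `zero-or-d` at 1 gives d = 1 modulo `K`.
        zero-or-one : ∀ u → mem K u ⊎ mem K (1# - u)
        zero-or-one u with zero-or-d u | zero-or-d 1#
        ... | inj₁ h | _      = inj₁ h
        ... | inj₂ _ | inj₁ h = ⊥-elim (1∉K h)
        ... | inj₂ h | inj₂ k = inj₂
          (resp K (solve 2 (λ d u → (d :- u) :- (d :- :1) := :1 :- u) refl d u) (sub-closed K h k))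

-- Integrality and inverse fractions of primes.

module Dedekind {c ℓ : Level} (R : CommutativeRing c ℓ)
  (dedekind : RingDefs.IsDedekindDomain R) (lem : (A : Set (c ⊔ ℓ)) → Dec A) where
  open CommutativeRing R hiding (zero)
  open RingDefs R
  open Ideals R
  open IntegerSolver R using (solve; _:=_; _:+_; _:*_; _:-_; :-_; con)
  open Relation.Binary.Reasoning.Setoid setoid

  noetherian = proj₁ (proj₂ dedekind)
  open Chains R noetherian lem

  no-zero-divisors : ∀ {a b} → ¬ (a ≈ 0#) → a * b ≈ 0# → b ≈ 0#
  no-zero-divisors {a} {b} a≉0 ab≈0 with proj₂ (proj₁ dedekind) a b ab≈0
  ... | inj₁ a≈0 = ⊥-elim (a≉0 a≈0)
  ... | inj₂ b≈0 = b≈0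

  cancelˡ : ∀ {a x y} → ¬ (a ≈ 0#) → a * x ≈ a * y → x ≈ y
  cancelˡ {a} {x} {y} a≉0 e = begin
    x            ≈⟨ solve 2 (λ x y → x := (x :- y) :+ y) refl x y ⟩
    (x - y) + y  ≈⟨ +-congʳ (no-zero-divisors a≉0 a[x-y]≈0) ⟩
    0# + y       ≈⟨ +-identityˡ y ⟩
    y            ∎
    where
    a[x-y]≈0 : a * (x - y) ≈ 0#
    a[x-y]≈0 = begin
      a * (x - y)    ≈⟨ solve 3 (λ a x y → a :* (x :- y) := a :* x :- a :* y) refl a x y ⟩
      a * x - a * y  ≈⟨ +-congʳ e ⟩
      a * y - a * y  ≈⟨ -‿inverseʳ _ ⟩
      0#             ∎

  sumFin-cong : ∀ n {f g : Fin n → Carrier} → (∀ i → f i ≈ g i) → sumFin n f ≈ sumFin n g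
  sumFin-cong zero    h = refl
  sumFin-cong (suc n) h = +-cong (h fzero) (sumFin-cong n (λ i → h (fsuc i)))

  *-sumFin : ∀ n a (f : Fin n → Carrier) → a * sumFin n f ≈ sumFin n (λ i → a * f i)
  *-sumFin zero    a f = zeroʳ a
  *-sumFin (suc n) a f = trans (distribˡ _ _ _) (+-congˡ (*-sumFin n a (λ i → f (fsuc i))))

  snoc : ∀ {n} → (Fin n → Carrier) → Carrier → Fin (suc n) → Carrier
  snoc {zero}  A r _        = r
  snoc {suc n} A r fzero    = A fzero
  snoc {suc n} A r (fsuc i) = snoc (λ j → A (fsuc j)) r i

  sumFin-snoc : ∀ n (A : Fin n → Carrier) r (g : ℕ → Carrier) →
    sumFin (suc n) (λ i → snoc A r i * g (toℕ i)) ≈ sumFin n (λ i → A i * g (toℕ i)) + r * g n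
  sumFin-snoc zero    A r g = +-comm _ _
  sumFin-snoc (suc n) A r g =
    trans (+-congˡ (sumFin-snoc n (λ j → A (fsuc j)) r (λ k → g (suc k)))) (sym (+-assoc _ _ _))

  -- Here a (sequence (n + 1)) = b (sequence n), i.e. sequence n = (b / a)ⁿ (sequence 0). The
  -- chain of spans of initial segments stabilises, which makes b / a integral.
  module Integrality (a b : Carrier) (sequence : ℕ → Carrier)
    (recurrence : ∀ n → a * sequence (suc n) ≈ b * sequence n) where

    span : ℕ → Ideal
    span zero    = record
      { mem = λ x → Lift c (x ≈ 0#)
      ; resp = λ { x≈y (lift e) → lift (trans (sym x≈y) e) }
      ; zero-in = lift refl
      ; +-closed = λ { (lift e) (lift e′) → lift (trans (+-cong e e′) (+-identityˡ _)) }
      ; *-closed = λ { r (lift e) → lift (trans (*-congˡ e) (zeroʳ r)) }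
      }
    span (suc n) = span n +⟨ sequence n ⟩

    power-recurrence : ∀ n → pow a n * sequence n ≈ pow b n * sequence 0
    power-recurrence zero    = refl
    power-recurrence (suc n) = begin
      (a * pow a n) * sequence (suc n)  ≈⟨ solve 3 (λ a p s → (a :* p) :* s := p :* (a :* s)) refl a (pow a n) _ ⟩
      pow a n * (a * sequence (suc n))  ≈⟨ *-congˡ (recurrence n) ⟩
      pow a n * (b * sequence n)        ≈⟨ solve 3 (λ b p s → p :* (b :* s) := b :* (p :* s)) refl b (pow a n) _ ⟩
      b * (pow a n * sequence n)        ≈⟨ *-congˡ (power-recurrence n) ⟩
      b * (pow b n * sequence 0)        ≈⟨ *-assoc _ _ _ ⟨
      (b * pow b n) * sequence 0        ∎

    -- This is a^n times the value at b / a of the polynomial with coefficients `A`, in the shape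
    -- that `IsIntegrallyClosed` asks for.
    form : ∀ n → (Fin n → Carrier) → Carrier
    form n A = sumFin n (λ i → A i * (pow b (toℕ i) * pow a (n ∸ toℕ i)))

    form-suc : ∀ n A r → form (suc n) (snoc A r) ≈ a * form n A + r * (pow b n * a)
    form-suc n A r = begin
      form (suc n) (snoc A r)
        ≈⟨ sumFin-snoc n A r (λ k → pow b k * pow a (suc n ∸ k)) ⟩
      sumFin n (λ i → A i * (pow b (toℕ i) * pow a (suc n ∸ toℕ i))) + r * (pow b n * pow a (suc n ∸ n))
        ≈⟨ +-cong (sumFin-cong n scale) (*-congˡ (*-congˡ last)) ⟩
      sumFin n (λ i → a * (A i * (pow b (toℕ i) * pow a (n ∸ toℕ i)))) + r * (pow b n * a)
        ≈⟨ +-congʳ (*-sumFin n a _) ⟨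
      a * form n A + r * (pow b n * a) ∎
      where
      last : pow a (suc n ∸ n) ≈ a
      last = trans (reflexive (≡.cong (pow a) (ℕₚ.m+n∸n≡m 1 n))) (*-identityʳ a)
      scale : ∀ i → A i * (pow b (toℕ i) * pow a (suc n ∸ toℕ i)) ≈ a * (A i * (pow b (toℕ i) * pow a (n ∸ toℕ i)))
      scale i = trans
        (*-congˡ (*-congˡ (reflexive (≡.cong (pow a) (ℕₚ.+-∸-assoc 1 (ℕₚ.<⇒≤ (toℕ<n i)))))))
        (solve 4 (λ a r p q → r :* (p :* (a :* q)) := a :* (r :* (p :* q))) refl a (A i) (pow b (toℕ i)) (pow a (n ∸ toℕ i)))

    -- Elements of the span are `sequence 0` times a polynomial in b / a of degree below n; the
    -- factor a^n clears denominators.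
    span-form : ∀ n y → mem (span n) y → ∃ λ A → pow a n * y ≈ sequence 0 * form n A
    span-form zero    y (lift e)        = (λ ()) , trans (*-congˡ e) (trans (zeroʳ _) (sym (zeroʳ _)))
    span-form (suc n) y (k , r , k∈ , e) with span-form n k k∈
    ... | A , ih = snoc A r , (begin
      (a * pow a n) * y
        ≈⟨ *-congˡ e ⟩
      (a * pow a n) * (k + r * s)
        ≈⟨ solve 5 (λ a p k r s → (a :* p) :* (k :+ r :* s) := a :* (p :* k) :+ (a :* r) :* (p :* s)) refl a (pow a n) k r s ⟩
      a * (pow a n * k) + (a * r) * (pow a n * s)
        ≈⟨ +-cong (*-congˡ ih) (*-congˡ (power-recurrence n)) ⟩
      a * (sequence 0 * form n A) + (a * r) * (pow b n * sequence 0)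
        ≈⟨ solve 5 (λ a t f r q → a :* (t :* f) :+ (a :* r) :* (q :* t) := t :* (a :* f :+ r :* (q :* a))) refl
             a (sequence 0) (form n A) r (pow b n) ⟩
      sequence 0 * (a * form n A + r * (pow b n * a))
        ≈⟨ *-congˡ (form-suc n A r) ⟨
      sequence 0 * form (suc n) (snoc A r) ∎)
      where s = sequence n

    divides : ¬ (a ≈ 0#) → ¬ (sequence 0 ≈ 0#) → ∃ λ r → b ≈ r * a
    divides a≉0 s≉0
      with chain-stabilises span (λ n → +⟨⟩-left (span n) (sequence n))
    ... | N , stops
      -- `sequence N` already lies in `span N`. Its negative is expanded so that, after cancelling
      -- `sequence 0`, the relation for b / a is monic with the required sign.
      with span-form N (- sequence N)
             (neg-closed (span N) (stops (suc N) _ (+⟨⟩-right (span N) (sequence N))))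
    ... | A , e = proj₁ (proj₂ (proj₂ dedekind)) b a a≉0 N A (no-zero-divisors s≉0 (begin
      sequence 0 * (pow b N + form N A)
        ≈⟨ solve 3 (λ s p f → s :* (p :+ f) := p :* s :+ s :* f) refl (sequence 0) (pow b N) (form N A) ⟩
      pow b N * sequence 0 + sequence 0 * form N A
        ≈⟨ +-cong (power-recurrence N) e ⟨
      pow a N * sequence N + pow a N * - sequence N
        ≈⟨ solve 2 (λ p s → p :* s :+ p :* (:- s) := con (+ 0)) refl (pow a N) (sequence N) ⟩
      0# ∎))

  -- If b / a carries `Q` into itself, iterating it on a nonzero element gives a sequence to which
  -- `Integrality` applies.
  divides-of-stable-multiples : (Q : Ideal) → ∀ a b → ¬ (a ≈ 0#) →
    ((q , _) : ∃ (mem Q)) → ¬ (q ≈ 0#) →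
    (∀ q → mem Q q → ∃ λ z → mem Q z × (a * z ≈ b * q)) → ∃ λ r → b ≈ r * a
  divides-of-stable-multiples Q a b a≉0 initial initial≉0 next =
    Integrality.divides a b (λ n → proj₁ (sequence n)) recurrence a≉0 initial≉0
    where
    sequence : ℕ → ∃ (mem Q)
    sequence zero    = initial
    sequence (suc n) = let z , z∈Q , _ = next (proj₁ (sequence n)) (proj₂ (sequence n)) in z , z∈Q
    recurrence : ∀ n → a * proj₁ (sequence (suc n)) ≈ b * proj₁ (sequence n)
    recurrence n = proj₂ (proj₂ (next (proj₁ (sequence n)) (proj₂ (sequence n))))

  -- The fraction b / a multiplies Q into R but, as witnessed by x = (b / a) q, not into Q.
  record InverseFraction (Q : Ideal) : Set (c ⊔ ℓ) where
    field
      a b q x : Carrier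
      a≉0     : ¬ (a ≈ 0#)
      bQ⊆a    : ∀ {y} → mem Q y → ∃ λ z → b * y ≈ a * z
      q∈Q     : mem Q q
      ax≈bq   : a * x ≈ b * q
      x∉Q     : ¬ mem Q x

  -- An annihilator of some `b` modulo `a`, maximal among those inside `Q`, is prime and contains
  -- `a`; dimension one makes it equal to `Q`. So b / a maps `Q` into R, while `a` does not divide
  -- `b`; by integral closedness b / a cannot map `Q` into itself.
  inverse-fraction : (Q : Ideal) → IsPrime Q → NonzeroIdeal Q → InverseFraction Q
  inverse-fraction Q (1∉Q , prime) (a , a∈Q , a≉0) =
    from-maximal (maximal-member annihilator (λ b → mem (annihilator b) ⊆ mem Q) (1# , annihilator-1⊆Q))
    where
    annihilator : Carrier → Ideal
    annihilator b = multiplesWith a b wholeIdeal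

    annihilator-1⊆Q : mem (annihilator 1#) ⊆ mem Q
    annihilator-1⊆Q y (z , _ , e) = resp Q (trans (sym e) (*-identityˡ y)) (*-closedʳ Q a∈Q z)

    module _ (b : Carrier) (ann⊆Q : mem (annihilator b) ⊆ mem Q)
      (max : ∀ b′ → mem (annihilator b′) ⊆ mem Q → mem (annihilator b) ⊆ mem (annihilator b′) →
             mem (annihilator b′) ⊆ mem (annihilator b)) where

      ann-multiple : ∀ s → mem (annihilator b) ⊆ mem (annihilator (b * s))
      ann-multiple s y (z , _ , e) = s * z , _ , (begin
        (b * s) * y  ≈⟨ solve 3 (λ b s y → (b :* s) :* y := s :* (b :* y)) refl b s y ⟩
        s * (b * y)  ≈⟨ *-congˡ e ⟩
        s * (a * z)  ≈⟨ solve 3 (λ a s z → s :* (a :* z) := a :* (s :* z)) refl a s z ⟩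
        a * (s * z)  ∎)

      ann-shift : ∀ s y → mem (annihilator (b * s)) y → mem (annihilator b) (s * y)
      ann-shift s y (z , _ , e) = z , _ , trans (sym (*-assoc b s y)) e

      ann-unshift : ∀ s y → mem (annihilator b) (s * y) → mem (annihilator (b * s)) y
      ann-unshift s y (z , _ , e) = z , _ , trans (*-assoc b s y) e

      -- If y kills b s modulo `a`, then s y kills `b` and so lies in `Q`, which forces y into `Q`;
      -- maximality then applies to b s.
      ann-outside : ∀ s → ¬ mem Q s → mem (annihilator (b * s)) ⊆ mem (annihilator b)
      ann-outside s s∉Q = max (b * s) bs⊆Q (ann-multiple s)
        where
        bs⊆Q : mem (annihilator (b * s)) ⊆ mem Q
        bs⊆Q y h with prime s y (ann⊆Q _ (ann-shift s y h))
        ... | inj₁ s∈Q = ⊥-elim (s∉Q s∈Q)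
        ... | inj₂ y∈Q = y∈Q

      -- If some s outside `Q` kills b x, then x kills b s and by `ann-outside` also `b`. Otherwise
      -- the annihilator of b x is inside `Q`, hence by maximality no larger than that of `b`, and
      -- it contains y.
      ann-prime : ∀ x y → mem (annihilator b) (x * y) → mem (annihilator b) x ⊎ mem (annihilator b) y
      ann-prime x y xy∈ with lem (mem (annihilator b) y)
                           | lem (∃ λ s → mem (annihilator (b * x)) s × ¬ mem Q s)
      ... | yes y∈ | _ = inj₂ y∈
      ... | no _   | yes (s , s∈ , s∉Q) = inj₁ (ann-outside s s∉Q x
        (ann-unshift s x (resp (annihilator b) (*-comm x s) (ann-shift x s s∈))))
      ... | no y∉  | no none = ⊥-elim (y∉ (max (b * x)
        (λ s s∈ → stable λ s∉Q → none (s , s∈ , s∉Q)) (ann-multiple x) y (ann-unshift x y xy∈)))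

      1∉ann : ¬ mem (annihilator b) 1#
      1∉ann h = 1∉Q (ann⊆Q 1# h)

      ann-nonzero : NonzeroIdeal (annihilator b)
      ann-nonzero = a , (b , _ , *-comm b a) , a≉0

      Q⊆ann : mem Q ⊆ mem (annihilator b)
      Q⊆ann with proj₂ (proj₂ (proj₂ (proj₂ dedekind)) (annihilator b) (1∉ann , ann-prime) ann-nonzero) Q ann⊆Q
      ... | inj₁ (Q⊆ , _) = Q⊆
      ... | inj₂ (_ , ⊇)  = ⊥-elim (1∉Q (⊇ 1# _))

      Moves : Set (c ⊔ ℓ)
      Moves = ∃ λ q → ∃ λ x → mem Q q × (a * x ≈ b * q) × ¬ mem Q x

      b∉a : ¬ (∃ λ r → b ≈ r * a)
      b∉a (r , e) = 1∉ann (r , _ , trans (*-identityʳ b) (trans e (*-comm r a)))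

      stays : ¬ Moves → ∀ q → mem Q q → ∃ λ z → mem Q z × (a * z ≈ b * q)
      stays none q q∈Q with Q⊆ann q q∈Q
      ... | z , _ , e = z , stable (λ z∉Q → none (q , z , q∈Q , sym e , z∉Q)) , sym e

      moves : Moves
      moves = stable λ none → b∉a (divides-of-stable-multiples Q a b a≉0 (a , a∈Q) a≉0 (stays none))

      fraction : Moves → InverseFraction Q
      fraction (q , x , q∈Q , ax≈bq , x∉Q) = record
        { a = a ; b = b ; q = q ; x = x ; a≉0 = a≉0
        ; bQ⊆a = λ y∈Q → let z , _ , e = Q⊆ann _ y∈Q in z , e
        ; q∈Q = q∈Q ; ax≈bq = ax≈bq ; x∉Q = x∉Q }

    from-maximal : ∃ (Maximal annihilator (λ b → mem (annihilator b) ⊆ mem Q)) → InverseFraction Q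
    from-maximal (b , ann⊆Q , max) = fraction b ann⊆Q max (moves b ann⊆Q max)

  index-2-dichotomy : (Q : Ideal) → ¬ mem Q 1# → HasIndex Q 2 → ∀ x → mem Q x ⊎ mem Q (1# - x)
  index-2-dichotomy Q 1∉Q (r , _ , cover) x with cover 0# | cover 1# | cover x
  ... | i , i≡ | j , j≡ | k , k≡ with fin2 i j k i≢j
    where
    fin2 : ∀ (i j k : Fin 2) → i ≢ j → k ≡ i ⊎ k ≡ j
    fin2 fzero        _            fzero        _ = inj₁ ≡.refl
    fin2 (fsuc fzero) _            (fsuc fzero) _ = inj₁ ≡.refl
    fin2 _            fzero        fzero        _ = inj₂ ≡.refl
    fin2 _            (fsuc fzero) (fsuc fzero) _ = inj₂ ≡.refl
    fin2 fzero        fzero        (fsuc fzero) h = ⊥-elim (h ≡.refl)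
    fin2 (fsuc fzero) (fsuc fzero) fzero        h = ⊥-elim (h ≡.refl)
    i≢j : i ≢ j
    i≢j ≡.refl = 1∉Q (resp Q (solve 1 (λ r → (:1 :- r) :- (con (+ 0) :- r) := :1) refl (r i)) (sub-closed Q j≡ i≡))
  ... | inj₁ ≡.refl = inj₁ (resp Q (solve 2 (λ x r → (x :- r) :- (con (+ 0) :- r) := x) refl x (r k)) (sub-closed Q k≡ i≡))
  ... | inj₂ ≡.refl = inj₂ (resp Q (solve 2 (λ x r → (:1 :- r) :- (x :- r) := :1 :- x) refl x (r k)) (sub-closed Q j≡ k≡))

  -- With 1 = (1 - x) + x and x = (b / a) q, every j ∈ J is (1 - x) j + q ((b / a) j).
  contains⇒divides : (Q J : Ideal) → InverseFraction Q → IsPrime Q → HasIndex Q 2 → mem J ⊆ mem Q →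
                     mem J ≐ (mem Q · mem (J ∶ Q))
  contains⇒divides Q J inverse prime index J⊆Q = J⊆ , ·-least J (λ {y} {x} y∈Q x∈ → x∈ y y∈Q)
    where
    open InverseFraction inverse
    1-x∈Q : mem Q (1# - x)
    1-x∈Q with index-2-dichotomy Q (proj₁ prime) index x
    ... | inj₁ x∈Q = ⊥-elim (x∉Q x∈Q)
    ... | inj₂ h   = h
    J⊆ : mem J ⊆ (mem Q · mem (J ∶ Q))
    J⊆ j j∈J with bQ⊆a (J⊆Q j j∈J)
    ... | j′ , bj≈aj′ = ·-pair 1-x∈Q (λ y _ → *-closed J y j∈J) q∈Q j′∈
      (trans (solve 2 (λ j x → j := (:1 :- x) :* j :+ x :* j) refl j x) (+-congˡ xj≈qj′))
      where
      xj≈qj′ : x * j ≈ q * j′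
      xj≈qj′ = cancelˡ a≉0 (begin
        a * (x * j)   ≈⟨ *-assoc a x j ⟨
        (a * x) * j   ≈⟨ *-congʳ ax≈bq ⟩
        (b * q) * j   ≈⟨ solve 3 (λ b q j → (b :* q) :* j := q :* (b :* j)) refl b q j ⟩
        q * (b * j)   ≈⟨ *-congˡ bj≈aj′ ⟩
        q * (a * j′)  ≈⟨ solve 3 (λ a q j → q :* (a :* j) := a :* (q :* j)) refl a q j′ ⟩
        a * (q * j′)  ∎)
      j′∈ : mem (J ∶ Q) j′
      j′∈ y y∈Q with bQ⊆a y∈Q
      ... | w , by≈aw = resp J (cancelˡ a≉0 (begin
        a * (w * j)   ≈⟨ *-assoc a w j ⟨
        (a * w) * j   ≈⟨ *-congʳ by≈aw ⟨
        (b * y) * j   ≈⟨ solve 3 (λ b y j → (b :* y) :* j := y :* (b :* j)) refl b y j ⟩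
        y * (b * j)   ≈⟨ *-congˡ bj≈aj′ ⟩
        y * (a * j′)  ≈⟨ solve 3 (λ a y j → y :* (a :* j) := a :* (y :* j)) refl a y j′ ⟩
        a * (y * j′)  ∎)) (*-closed J w j∈J)

  -- `D` collects the y with (b / a) y in `Q`. It contains the square of `Q`, as b / a maps one
  -- factor into R, but no q s with s outside `Q`, as (b / a) q s = x s.
  element-outside-square : (Q : Ideal) → InverseFraction Q → IsPrime Q →
    ∃ λ q → ∃ λ (D : Ideal) → mem Q q × (∀ {u v} → mem Q u → mem Q v → mem D (u * v)) ×
            (∀ {s} → ¬ mem Q s → ¬ mem D (q * s))
  element-outside-square Q inverse (_ , prime) = q , multiplesWith a b Q , q∈Q , square , outside
    where
    open InverseFraction inverse
    square : ∀ {u v} → mem Q u → mem Q v → mem (multiplesWith a b Q) (u * v)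
    square {u} {v} u∈Q v∈Q with bQ⊆a u∈Q
    ... | z , e = z * v , *-closed Q z v∈Q , trans (sym (*-assoc b u v)) (trans (*-congʳ e) (*-assoc a z v))
    outside : ∀ {s} → ¬ mem Q s → ¬ mem (multiplesWith a b Q) (q * s)
    outside {s} s∉Q (z , z∈Q , e) with prime x s (resp Q (cancelˡ a≉0 (begin
        a * z        ≈⟨ e ⟨
        b * (q * s)  ≈⟨ *-assoc b q s ⟨
        (b * q) * s  ≈⟨ *-congʳ ax≈bq ⟨
        (a * x) * s  ≈⟨ *-assoc a x s ⟩
        a * (x * s)  ∎)) z∈Q)
    ... | inj₁ x∈Q = x∉Q x∈Q
    ... | inj₂ s∈Q = s∉Q s∈Q

-- Parity along walks, and the three diameters.

module Components {c ℓ : Level} (R : CommutativeRing c ℓ) where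
  open CommutativeRing R hiding (zero)
  open RingDefs R
  open Ideals R
  open IntegerSolver R using (solve; _:=_; _:+_; _:*_; _:-_; :-_)

  -- N plays the role of the intersection of the index-2 primes: the units of R/I are the odd
  -- residues modulo N that are units modulo J.
  module _ (I J N : Ideal)
    (unit⇒odd : ∀ {x} → IsUnitMod I x → mem N (1# - x))
    (odd-unit : ∀ {x} → mem N (1# - x) → IsUnitMod J x → IsUnitMod I x)
    (2∈N : mem N (1# + 1#)) (1∉N : ¬ mem N 1#) (I⊆N : mem I ⊆ mem N) (I⊆J : mem I ⊆ mem J) where

    Even Odd : Carrier → Set (c ⊔ ℓ)
    Even x = mem N x
    Odd x  = mem N (1# - x)

    odd+odd : ∀ {x y z} → z ≈ x + y → Odd x → Odd y → Even z
    odd+odd {x} {y} e h k = resp N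
      (trans (solve 2 (λ x y → (:1 :+ :1) :- ((:1 :- x) :+ (:1 :- y)) := x :+ y) refl x y) (sym e))
      (sub-closed N 2∈N (+-closed N h k))

    odd+even : ∀ {x y z} → z ≈ x + y → Odd x → Even y → Odd z
    odd+even {x} {y} e h k = resp N
      (trans (solve 2 (λ x y → (:1 :- x) :- y := :1 :- (x :+ y)) refl x y) (+-congˡ (-‿cong (sym e))))
      (sub-closed N h k)

    odd-odd : ∀ {x y z} → z ≈ x - y → Odd x → Odd y → Even z
    odd-odd {x} {y} e h k = resp N
      (trans (solve 2 (λ x y → (:1 :- y) :- (:1 :- x) := x :- y) refl x y) (sym e)) (sub-closed N k h)

    even-odd : ∀ {x y z} → z ≈ x - y → Even x → Odd y → Odd z
    even-odd {x} {y} e h k = resp N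
      (trans (solve 2 (λ x y → (:1 :+ :1) :- (x :+ (:1 :- y)) := :1 :- (x :- y)) refl x y) (+-congˡ (-‿cong (sym e))))
      (sub-closed N 2∈N (+-closed N h k))

    even⇒¬odd : ∀ {x} → Even x → ¬ Odd x
    even⇒¬odd {x} h k = 1∉N (resp N (solve 1 (λ x → x :+ (:1 :- x) := :1) refl x) (+-closed N h k))

    odd-1 : Odd 1#
    odd-1 = resp N (sym (-‿inverseʳ 1#)) (zero-in N)

    telescope : ∀ a b d → a - d ≈ (a - b) + (b - d)
    telescope = solve 3 (λ a b d → a :- d := (a :- b) :+ (b :- d)) refl

    walk-parity : ∀ {a b k} → Walk I a b k → Even (a - b) ⊎ Odd (a - b)
    walk-parity (here a≡b) = inj₁ (I⊆N _ a≡b)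
    walk-parity (step {a} {b} {d} adj w) with walk-parity w
    ... | inj₁ even = inj₂ (odd+even (telescope a b d) (unit⇒odd adj) even)
    ... | inj₂ odd  = inj₁ (odd+odd (telescope a b d) (unit⇒odd adj) odd)

    difference : ∀ a b e → b - e ≈ (a - e) - (a - b)
    difference = solve 3 (λ a b e → b :- e := (a :- e) :- (a :- b)) refl

    component-parity : ∀ {a b e} → Connected I a b → Connected I a e → Even (b - e) ⊎ Odd (b - e)
    component-parity {a} {b} {e} (_ , v) (_ , w) with walk-parity v | walk-parity w
    ... | inj₁ h | inj₁ k = inj₁ (resp N (sym (difference a b e)) (sub-closed N k h))
    ... | inj₁ h | inj₂ k = inj₂ (odd+even (difference a b e) k (neg-closed N h))
    ... | inj₂ h | inj₁ k = inj₂ (even-odd (difference a b e) k h)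
    ... | inj₂ h | inj₂ k = inj₁ (odd-odd (difference a b e) k h)

    walk₁ : ∀ {a b} → IsUnitMod I (a - b) → Walk I a b 1
    walk₁ {a} {b} u = step u (here (resp I (sym (-‿inverseʳ b)) (zero-in I)))

    walk-via : ∀ {a b k} u → IsUnitMod I u → Walk I (a - u) b k → Walk I a b (suc k)
    walk-via {a} u h w = step (unit-≈ I (solve 2 (λ a u → u := a :- (a :- u)) refl a u) h) w

    walk₁⇒unit : ∀ {a b} → Walk I a b 1 → IsUnitMod I (a - b)
    walk₁⇒unit (step {a} {b} {d} adj (here b≡d)) = unit-cong I
      (resp I (solve 3 (λ a b d → :- (b :- d) := (a :- b) :- (a :- d)) refl a b d) (neg-closed I b≡d)) adj

    walk₂⇒even : ∀ {a b} → Walk I a b 2 → Even (a - b)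
    walk₂⇒even (step {a} {b} {d} adj w) =
      odd+odd (telescope a b d) (unit⇒odd adj) (unit⇒odd (walk₁⇒unit w))

    connected-refl : ∀ a → Connected I a a
    connected-refl a = 0 , here (resp I (sym (-‿inverseʳ a)) (zero-in I))

    a-[a-x] : ∀ a x → a - (a - x) ≈ x
    a-[a-x] = solve 2 (λ a x → a :- (a :- x) := x) refl

    -- Starting at the given vertex `a` places a far pair in every component; only the difference
    -- `x` remains to be chosen.
    distant-pair : ∀ {a x D} → Walk I a (a - x) D → (∀ k → k < D → ¬ Walk I a (a - x) k) →
                   ∃ λ b → ∃ λ e → Connected I a b × Connected I a e × Dist I b e D
    distant-pair {a} {x} w min = a , a - x , connected-refl a , (_ , w) , w , min

    walk₀⇒∈ : ∀ {a x} → Walk I a (a - x) 0 → mem I x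
    walk₀⇒∈ {a} {x} (here h) = resp I (a-[a-x] a x) h

    -- Even differences vanish modulo `I` and odd ones are units, so each component is a single
    -- edge.
    diameter-1 : mem N ⊆ mem I → (∀ x → IsUnitMod J x) → AllComponentsDiameter I 1
    diameter-1 N⊆I unitJ a = upper , distant-pair
      (walk₁ (unit-≈ I (sym (a-[a-x] a 1#)) (unit-1 I))) λ where
        zero    _        w → 1∉N (I⊆N _ (walk₀⇒∈ w))
        (suc _) (s≤s ())
      where
      upper : ∀ b e → Connected I a b → Connected I a e → ∃ λ k → k ≤ 1 × Walk I b e k
      upper b e v w with component-parity v w
      ... | inj₁ even = 0 , z≤n , here (N⊆I _ even)
      ... | inj₂ odd  = 1 , ℕₚ.≤-refl , walk₁ (odd-unit odd (unitJ _))

    -- An even difference is 1 plus an odd one, both units. The given `x` is nonzero modulo `I` and,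
    -- being even, not a unit.
    diameter-2 : (∀ x → IsUnitMod J x) → (∃ λ x → mem N x × ¬ mem I x) → AllComponentsDiameter I 2
    diameter-2 unitJ (x , x∈N , x∉I) a = upper , distant-pair
      (even-walk (resp N (sym (a-[a-x] a x)) x∈N)) λ where
        zero          _              w → x∉I (walk₀⇒∈ w)
        (suc zero)    _              w → even⇒¬odd (resp N (sym (a-[a-x] a x)) x∈N) (unit⇒odd (walk₁⇒unit w))
        (suc (suc _)) (s≤s (s≤s ()))
      where
      even-walk : ∀ {b e} → Even (b - e) → Walk I b e 2
      even-walk {b} {e} even = walk-via 1# (unit-1 I)
        (walk₁ (odd-unit (even-odd (solve 2 (λ b e → (b :- :1) :- e := (b :- e) :- :1) refl b e) even odd-1) (unitJ _)))
      upper : ∀ b e → Connected I a b → Connected I a e → ∃ λ k → k ≤ 2 × Walk I b e k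
      upper b e v w with component-parity v w
      ... | inj₁ even = 2 , ℕₚ.≤-refl , even-walk even
      ... | inj₂ odd  = 1 , s≤s z≤n , walk₁ (odd-unit odd (unitJ _))

    -- The far difference is `s`: being odd excludes lengths 0 and 2, and lying in the proper ideal
    -- `J` excludes length 1.
    diameter-3 : ¬ mem J 1# → (∀ d → ∃ λ u → IsUnitMod J (u * (d - u))) → Comaximal J N →
                 AllComponentsDiameter I 3
    diameter-3 1∉J sum (s , s∈J , s-odd) a = upper , distant-pair
      (odd-walk (resp N (+-congˡ (-‿cong (sym (a-[a-x] a s)))) s-odd)) λ where
        zero                _ w → even⇒¬odd (I⊆N _ (walk₀⇒∈ w)) s-odd
        (suc zero)          _ w → not-unit (unit-≈ I (a-[a-x] a s) (walk₁⇒unit w))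
        (suc (suc zero))    _ w → even⇒¬odd (resp N (a-[a-x] a s) (walk₂⇒even w)) s-odd
        (suc (suc (suc _))) (s≤s (s≤s (s≤s ())))
      where
      not-unit : ¬ IsUnitMod I s
      not-unit h = 1∉J (unit-cancel J (unit-mono I J I⊆J h) (*-closedʳ J s∈J 1#))

      even-walk : ∀ {b e} → Even (b - e) → Walk I b e 2
      even-walk {b} {e} even = from (sum (b - e))
        where
        from : (∃ λ u → IsUnitMod J (u * ((b - e) - u))) → Walk I b e 2
        from (u₀ , h) = walk-via u (odd-unit u-odd (unit-cong J u₀≡u (unit-factorˡ J h)))
          (walk₁ (odd-unit (even-odd swap even u-odd) (unit-cong J rest≡ (unit-factorˡ J (unit-≈ J (*-comm _ _) h)))))
          where
          -- Adding a multiple of `s` keeps the class modulo `J` and makes the unit 1 modulo `N`.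
          u = u₀ + s * (1# - u₀)
          u-odd : Odd u
          u-odd = resp N (solve 2 (λ s u₀ → (:1 :- s) :* (:1 :- u₀) := :1 :- (u₀ :+ s :* (:1 :- u₀))) refl s u₀)
            (*-closedʳ N s-odd _)
          u₀≡u : mem J (u₀ - u)
          u₀≡u = resp J (solve 2 (λ s u₀ → s :* (u₀ :- :1) := u₀ :- (u₀ :+ s :* (:1 :- u₀))) refl s u₀)
            (*-closedʳ J s∈J _)
          swap : (b - u) - e ≈ (b - e) - u
          swap = solve 3 (λ b u e → (b :- u) :- e := (b :- e) :- u) refl b u e
          rest≡ : mem J (((b - e) - u₀) - ((b - u) - e))
          rest≡ = resp J (solve 4 (λ b e u₀ u → :- (u₀ :- u) := ((b :- e) :- u₀) :- ((b :- u) :- e)) refl b e u₀ u)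
            (neg-closed J u₀≡u)

      odd-walk : ∀ {b e} → Odd (b - e) → Walk I b e 3
      odd-walk {b} {e} odd = walk-via 1# (unit-1 I)
        (even-walk (odd-odd (solve 2 (λ b e → (b :- :1) :- e := (b :- e) :- :1) refl b e) odd odd-1))

      upper : ∀ b e → Connected I a b → Connected I a e → ∃ λ k → k ≤ 3 × Walk I b e k
      upper b e v w with component-parity v w
      ... | inj₁ even = 2 , s≤s (s≤s z≤n) , even-walk even
      ... | inj₂ odd  = 3 , ℕₚ.≤-refl , odd-walk odd

-- For a proposition A, the ideal { x | x ∈ P or A } is P or R according to whether A fails or holds.
maximal⇒excluded-middle : ∀ {c ℓ} (R : CommutativeRing c ℓ) → let open RingDefs R in
  (P : Ideal) → IsMaximal P → (A : Set (c ⊔ ℓ)) → Dec A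
maximal⇒excluded-middle {c} {ℓ} R P (1∉P , max) A = decide (max K (λ _ → inj₁))
  where
  open CommutativeRing R hiding (zero)
  open RingDefs R
  K : Ideal
  K = record
    { mem      = λ x → mem P x ⊎ A
    ; resp     = λ { e (inj₁ h) → inj₁ (resp P e h) ; e (inj₂ p) → inj₂ p }
    ; zero-in  = inj₁ (zero-in P)
    ; +-closed = λ { (inj₁ h) (inj₁ k) → inj₁ (+-closed P h k)
                   ; (inj₂ p) _ → inj₂ p ; (inj₁ _) (inj₂ p) → inj₂ p }
    ; *-closed = λ { r (inj₁ h) → inj₁ (*-closed P r h) ; r (inj₂ p) → inj₂ p }
    }
  decide : (mem K ≐ mem P) ⊎ (mem K ≐ whole) → Dec A
  decide (inj₁ (K⊆P , _)) = no λ p → 1∉P (K⊆P 1# (inj₂ p))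
  decide (inj₂ (_ , R⊆K)) with R⊆K 1# _
  ... | inj₁ 1∈P = ⊥-elim (1∉P 1∈P)
  ... | inj₂ p   = yes p

-- The factors of the ideal `I`.

module Factorisation {c ℓ : Level} (R : CommutativeRing c ℓ) where
  open CommutativeRing R hiding (zero)
  open RingDefs R
  open Ideals R
  open IntegerSolver R using (solve; _:=_; _:+_; _:*_; _:-_; :-_)

  module _ (dedekind : IsDedekindDomain) (lem : (A : Set (c ⊔ ℓ)) → Dec A)
    {m : ℕ} (I : Ideal) (P : Fin (suc m) → Ideal) (α : Fin (suc m) → ℕ) (J : Ideal)
    (nonzero : NonzeroIdeal I) (finite : FiniteQuotient I)
    (prime : ∀ i → IsPrime (P i)) (distinct : ∀ i j → i ≢ j → ¬ (mem (P i) ≐ mem (P j)))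
    (index-2 : ∀ i → HasIndex (P i) 2) (1≤α : ∀ i → 1 ≤ α i)
    (J-free : ∀ (Q : Ideal) → IsPrime Q → HasIndex Q 2 → ¬ (∃ λ (K : Ideal) → mem J ≐ (mem Q · mem K)))
    (I≐ : mem I ≐ (prodᴵ (suc m) (λ i → mem (P i) ^ᴵ α i) · mem J)) where
    open Dedekind R dedekind lem
    open Chains R noetherian lem

    dichotomy : ∀ i x → mem (P i) x ⊎ mem (P i) (1# - x)
    dichotomy i = index-2-dichotomy (P i) (proj₁ (prime i)) (index-2 i)

    I⊆ : ∀ i (K : Ideal) → (mem (P i) ^ᴵ α i) ⊆ mem K → mem I ⊆ mem K
    I⊆ i K h x x∈I = prodᴵ-·-⊆ (suc m) (λ j → mem (P j) ^ᴵ α j) (mem J) i K h x (proj₁ I≐ x x∈I)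

    I⊆P : ∀ i → mem I ⊆ mem (P i)
    I⊆P i = I⊆ i (P i) (^ᴵ-⊆ (P i) (α i) (1≤α i))

    I⊆J : mem I ⊆ mem J
    I⊆J x x∈I = ·-least J (λ _ j → *-closed J _ j) x (proj₁ I≐ x x∈I)

    nonzero-⊇ : (K : Ideal) → mem I ⊆ mem K → NonzeroIdeal K
    nonzero-⊇ K I⊆K = let x , x∈I , x≉0 = nonzero in x , I⊆K x x∈I , x≉0

    N : Ideal
    N = ⋂ P

    -- A unit modulo `I` lies in no `P i`, and the only other class modulo `P i` is that of 1.
    unit⇒odd : ∀ {x} → IsUnitMod I x → mem N (1# - x)
    unit⇒odd {x} h i with dichotomy i x
    ... | inj₂ odd = odd
    ... | inj₁ x∈P = ⊥-elim (proj₁ (prime i)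
      (unit-cancel (P i) (unit-mono I (P i) (I⊆P i) h) (*-closedʳ (P i) x∈P 1#)))

    -- Modulo each `P i` the inverse is 1; invertibility then passes to powers and products of
    -- ideals.
    odd-unit : ∀ {x} → mem N (1# - x) → IsUnitMod J x → IsUnitMod I x
    odd-unit {x} odd h = invertible⇒unit I
      (let u , k = invertible-· (invertible-prodᴵ (suc m) {λ i → mem (P i) ^ᴵ α i} invertible-power)
                     (unit⇒invertible J h)
       in u , proj₂ I≐ _ k)
      where
      odd-invertible : ∀ i → Invertible (mem (P i)) x
      odd-invertible i = 1# , resp (P i) (+-congˡ (-‿cong (sym (*-identityʳ x)))) (odd i)
      invertible-power : ∀ i → Invertible (mem (P i) ^ᴵ α i) x
      invertible-power i = invertible-^ᴵ {mem (P i)} (odd-invertible i) (α i)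

    2∈N : mem N (1# + 1#)
    2∈N i with dichotomy i (1# + 1#)
    ... | inj₁ h = h
    ... | inj₂ h = ⊥-elim (proj₁ (prime i)
      (resp (P i) (solve 0 (:- (:1 :- (:1 :+ :1)) := :1) refl) (neg-closed (P i) h)))

    1∉N : ¬ mem N 1#
    1∉N h = proj₁ (prime fzero) (h fzero)

    -- `Q` would contain the nonzero ideal `I`, hence have an inverse fraction, and containment
    -- would become divisibility.
    J⊈ : ∀ Q → IsPrime Q → HasIndex Q 2 → ¬ (mem J ⊆ mem Q)
    J⊈ Q Q-prime index J⊆Q = J-free Q Q-prime index
      (J ∶ Q , contains⇒divides Q J (inverse-fraction Q Q-prime (nonzero-⊇ Q λ x x∈I → J⊆Q x (I⊆J x x∈I)))
                 Q-prime index J⊆Q)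

    comaximal-from-element : (B : Ideal) → ∀ i {s} → mem B s → ¬ mem (P i) s → Comaximal B (P i)
    comaximal-from-element B i {s} s∈B s∉P with dichotomy i s
    ... | inj₁ s∈P = ⊥-elim (s∉P s∈P)
    ... | inj₂ h   = s , s∈B , h

    comaximal-⊈ : (B : Ideal) → ∀ i → ¬ (mem B ⊆ mem (P i)) → Comaximal B (P i)
    comaximal-⊈ B i B⊈P = stable λ none → B⊈P λ s s∈B → stable λ s∉P →
      none (comaximal-from-element B i s∈B s∉P)

    comaximal-sym : ∀ {A B : Ideal} → Comaximal A B → Comaximal B A
    comaximal-sym {A} {B} (s , s∈A , h) = 1# - s , h ,
      resp A (solve 1 (λ s → s := :1 :- (:1 :- s)) refl s) s∈A

    -- Otherwise neither prime has an element outside the other, and they coincide.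
    P-comaximal : ∀ i j → i ≢ j → Comaximal (P i) (P j)
    P-comaximal i j i≢j = stable λ none → distinct i j i≢j
      ( (λ s s∈Pᵢ → stable λ s∉Pⱼ → none (comaximal-from-element (P i) j s∈Pᵢ s∉Pⱼ))
      , (λ s s∈Pⱼ → stable λ s∉Pᵢ → none
          (comaximal-sym {P j} {P i} (comaximal-from-element (P j) i s∈Pⱼ s∉Pᵢ))))

    J-comaximal : Comaximal J N
    J-comaximal = comaximal-⋂ J P (λ i → comaximal-⊈ J i (J⊈ (P i) (prime i) (index-2 i)))

    N⊆I : mem J 1# → (∀ i → α i ≡ 1) → mem N ⊆ mem I
    N⊆I 1∈J α≡1 x x∈N = proj₂ I≐ x (·-single
      (prodᴵ-mono (suc m) (λ i y y∈P → ≡.subst (λ n → (mem (P i) ^ᴵ n) y) (≡.sym (α≡1 i))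
          (·-single y∈P _ (sym (*-identityʳ y)))) x (⋂⊆prodᴵ (suc m) P P-comaximal x x∈N))
      1∈J (sym (*-identityʳ x)))

    -- Let s lie in every other `P j` but not in `P i`, and let q come from
    -- `element-outside-square`. Then q s is in `N`, while `I` lies in `D` because the exponent of
    -- `P i` exceeds 1.
    N⊈I : (∃ λ i → 1 < α i) → ∃ λ x → mem N x × ¬ mem I x
    N⊈I (i , 1<α) = witness
      (element-outside-square (P i) (inverse-fraction (P i) (prime i) (nonzero-⊇ (P i) (I⊆P i))) (prime i))
      (comaximal-⋂ (P i) (λ k → P (punchIn i k)) (λ k → P-comaximal i (punchIn i k) (λ e → punchInᵢ≢i i k (≡.sym e))))
      where
      witness : (∃ λ q → ∃ λ (D : Ideal) → mem (P i) q ×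
                  (∀ {u v} → mem (P i) u → mem (P i) v → mem D (u * v)) ×
                  (∀ {s} → ¬ mem (P i) s → ¬ mem D (q * s))) →
                Comaximal (P i) (⋂ (λ k → P (punchIn i k))) → ∃ λ x → mem N x × ¬ mem I x
      witness (q , D , q∈P , square , outside) (t , t∈P , t-odd) = q * s , qs∈N ,
        λ qs∈I → outside s∉P (I⊆ i D (^ᴵ-⊆-square (P i) D square (α i) 1<α) _ qs∈I)
        where
        s = 1# - t
        s∉P : ¬ mem (P i) s
        s∉P s∈P = proj₁ (prime i) (resp (P i) (solve 1 (λ t → t :+ (:1 :- t) := :1) refl t) (+-closed (P i) t∈P s∈P))
        qs∈N : mem N (q * s)
        qs∈N j with i ≟ j
        ... | yes ≡.refl = *-closedʳ (P i) q∈P s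
        ... | no i≢j     = *-closed (P j) q
          (≡.subst (λ k → mem (P k) s) (punchIn-punchOut i≢j) (t-odd (punchOut i≢j)))

    units-mod-whole : mem J 1# → ∀ x → IsUnitMod J x
    units-mod-whole 1∈J x = 0# , 1∈⇒whole J 1∈J _

    open Components R

    diameters : ((mem J ≐ whole) → (∀ i → α i ≡ 1) → AllComponentsDiameter I 1) ×
                ((mem J ≐ whole) → (∃ λ i → 1 < α i) → AllComponentsDiameter I 2) ×
                (¬ (mem J ≐ whole) → AllComponentsDiameter I 3)
    diameters =
      (λ J≐ α≡1 → diameter-1 I J N unit⇒odd odd-unit 2∈N 1∉N (λ x h i → I⊆P i x h) I⊆J
        (N⊆I (proj₂ J≐ 1# _) α≡1) (units-mod-whole (proj₂ J≐ 1# _))) ,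
      (λ J≐ 1<α → diameter-2 I J N unit⇒odd odd-unit 2∈N 1∉N (λ x h i → I⊆P i x h) I⊆J
        (units-mod-whole (proj₂ J≐ 1# _)) (N⊈I 1<α)) ,
      (λ J≭ → diameter-3 I J N unit⇒odd odd-unit 2∈N 1∉N (λ x h i → I⊆P i x h) I⊆J
        (λ 1∈J → J≭ ((λ _ _ → _) , λ x _ → 1∈⇒whole J 1∈J x))
        (λ d → UnitSums.good-finite d I J finite I⊆J J⊈) J-comaximal)

theorem6p3 : ∀ {c ℓ} (R : CommutativeRing c ℓ) → let open RingDefs R in
    IsDedekindDomain →
    (m : ℕ) → 1 ≤ m →
    (I : Ideal) → (P : Fin m → Ideal) → (α : Fin m → ℕ) → (J : Ideal) →
    NonzeroIdeal I → FiniteQuotient I →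
    (∀ i → IsPrime (P i)) →
    (∀ i j → i ≢ j → ¬ (mem (P i) ≐ mem (P j))) →
    (∀ i → HasIndex (P i) 2) →
    (∀ i → 1 ≤ α i) →
    (∀ (Q : Ideal) → IsPrime Q → HasIndex Q 2 → ¬ (∃ λ (K : Ideal) → mem J ≐ (mem Q · mem K))) →
    (mem I ≐ (prodᴵ m (λ i → mem (P i) ^ᴵ α i) · mem J)) →
    ((mem J ≐ whole) → (∀ i → α i ≡ 1) → AllComponentsDiameter I 1) ×
    ((mem J ≐ whole) → (∃ λ i → 1 < α i) → AllComponentsDiameter I 2) ×
    (¬ (mem J ≐ whole) → AllComponentsDiameter I 3)
theorem6p3 R dedekind (suc m) _ I P α J nonzero finite prime distinct index-2 1≤α J-free I≐ =
  Factorisation.diameters R dedekind lem I P α J nonzero finite prime distinct index-2 1≤α J-free I≐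
  where
  open RingDefs R
  open Ideals R
  P₀ = P fzero
  I⊆P₀ : mem I ⊆ mem P₀
  I⊆P₀ x x∈I = prodᴵ-·-⊆ (suc m) (λ i → mem (P i) ^ᴵ α i) (mem J) fzero P₀
    (^ᴵ-⊆ P₀ (α fzero) (1≤α fzero)) x (proj₁ I≐ x x∈I)
  -- `P₀` contains the nonzero ideal `I`, so dimension one makes it maximal.
  lem = maximal⇒excluded-middle R P₀ (proj₂ (proj₂ (proj₂ dedekind)) P₀ (prime fzero)
    (let x , x∈I , x≉0 = nonzero in x , I⊆P₀ x x∈I , x≉0))
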